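{- Let $F$ be a graph with chromatic number $\chi(F)\geq 4$, and let $F^{o}$ be an odd-ballooning of $F$ in which every substituted odd cycle has length at least five. Then for all sufficiently large $n$ (depending on $F^{o}$), ${\rm EX}(n,F^{o})={\rm EX}(n,F)$.
   Context: For a family $\mathcal{F}$ of graphs, a graph is $\mathcal{F}$-free if it contains no subgraph isomorphic to a member of $\mathcal{F}$; ${\rm ex}(n,\mathcal{F})$ is the maximum number of edges of an $n$-vertex $\mathcal{F}$-free graph, and ${\rm EX}(n,\mathcal{F})$ is the set of $n$-vertex $\mathcal{F}$-free graphs with exactly ${\rm ex}(n,\mathcal{F})$ edges (for a single graph $F$ write ${\rm ex}(n,F)$, ${\rm EX}(n,F)$). The odd-ballooning $F^{o}$ of a graph $F$ is obtained from $F$ by replacing each edge $uv$ with an odd cycle $C(u,v)$ through the edge $uv$ (i.e., adding a new path between $u$ and $v$ of even length $\ell_{u,v}-1$ with new internal vertices), where all new vertices of the different cycles are distinct; different edges may receive odd cycles of different lengths $\ell_{u,v}$. Here every $\ell_{u,v}\geq 5$. -}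

module Defs where

open import Data.Bool using (Bool; true; false; T; _∧_; if_then_else_)
open import Data.Nat using (ℕ; zero; suc; _+_; _∸_; _≤_; _<_; _<ᵇ_; _%_)
open import Data.Fin using (Fin; toℕ)
open import Data.List using (List; map; allFin)
open import Data.Nat.ListAction using (sum)
open import Data.Product using (Σ; _×_; _,_; ∃-syntax)
open import Data.Sum using (_⊎_; inj₁; inj₂)
open import Relation.Nullary using (¬_)
open import Relation.Binary.PropositionalEquality using (_≡_; _≢_)
open import Function.Definitions using (Injective)

record SimpleGraph (n : ℕ) : Set where
  field
    adj    : Fin n → Fin n → Bool
    sym    : ∀ i j → adj i j ≡ adj j i
    irrefl : ∀ i → adj i i ≡ false
open SimpleGraph public

edgeCount : ∀ {n} → SimpleGraph n → ℕ
edgeCount {n} G =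
  sum (map (λ i → sum (map (λ j → if (toℕ i <ᵇ toℕ j) ∧ adj G i j then 1 else 0)
                           (allFin n)))
           (allFin n))

record Pattern : Set₁ where
  field
    V   : Set
    Adj : V → V → Set
open Pattern public

Contains : ∀ {n} → Pattern → SimpleGraph n → Set
Contains H G = Σ (V H → Fin _) λ f →
  Injective _≡_ _≡_ f × (∀ x y → Adj H x y → T (adj G (f x) (f y)))

Free : ∀ {n} → Pattern → SimpleGraph n → Set
Free H G = ¬ Contains H G

InEX : (H : Pattern) (n : ℕ) → SimpleGraph n → Set
InEX H n G = Free H G × (∀ (G' : SimpleGraph n) → Free H G' → edgeCount G' ≤ edgeCount G)

toPattern : ∀ {k} → SimpleGraph k → Pattern
toPattern {k} F = record { V = Fin k ; Adj = λ u v → T (adj F u v) }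

ChromaticGE4 : ∀ {k} → SimpleGraph k → Set
ChromaticGE4 {k} F = ¬ (Σ (Fin k → Fin 3) λ c → ∀ u v → T (adj F u v) → c u ≢ c v)

-- Each edge of F is taken once, as the ordered pair (u , v) with u < v.
IsEdgeLT : ∀ {k} → SimpleGraph k → Fin k → Fin k → Set
IsEdgeLT F u v = T ((toℕ u <ᵇ toℕ v) ∧ adj F u v)

ValidLengths : ∀ {k} → SimpleGraph k → (Fin k → Fin k → ℕ) → Set
ValidLengths F ℓ = ∀ u v → IsEdgeLT F u v → (ℓ u v % 2 ≡ 1) × (5 ≤ ℓ u v)

-- Vertices of the odd-ballooning: original vertices, plus ℓ(u,v) - 2 new internal
-- vertices for each edge uv (u < v) of F.
BVert : ∀ {k} → SimpleGraph k → (Fin k → Fin k → ℕ) → Set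
BVert {k} F ℓ = Fin k ⊎ (Σ (Fin k) λ u → Σ (Fin k) λ v → IsEdgeLT F u v × Fin (ℓ u v ∸ 2))

-- Adjacency of the odd-ballooning: each edge uv of F is kept and the path
-- u - w₀ - w₁ - … - w_{ℓ-3} - v (length ℓ-1) is added, so C(u,v) is an ℓ-cycle.
data BAdj {k} (F : SimpleGraph k) (ℓ : Fin k → Fin k → ℕ) : BVert F ℓ → BVert F ℓ → Set where
  base  : ∀ u v → T (adj F u v) → BAdj F ℓ (inj₁ u) (inj₁ v)
  first : ∀ u v (p : IsEdgeLT F u v) (i : Fin (ℓ u v ∸ 2)) → toℕ i ≡ 0 →
          BAdj F ℓ (inj₁ u) (inj₂ (u , v , p , i))
  step  : ∀ u v (p : IsEdgeLT F u v) (i j : Fin (ℓ u v ∸ 2)) → toℕ j ≡ suc (toℕ i) →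
          BAdj F ℓ (inj₂ (u , v , p , i)) (inj₂ (u , v , p , j))
  last  : ∀ u v (p : IsEdgeLT F u v) (i : Fin (ℓ u v ∸ 2)) → suc (toℕ i) ≡ ℓ u v ∸ 2 →
          BAdj F ℓ (inj₂ (u , v , p , i)) (inj₁ v)
  symm  : ∀ x y → BAdj F ℓ x y → BAdj F ℓ y x

OddBallooning : ∀ {k} → SimpleGraph k → (Fin k → Fin k → ℕ) → Pattern
OddBallooning F ℓ = record { V = BVert F ℓ ; Adj = BAdj F ℓ }

{-# OPTIONS --safe #-}
module Submission where

-- Let s be the largest number such that F is not s-colourable (s ≥ 3); then Fᵒ is (s+1)-colourable, because the new
-- even paths can be coloured with the help of a third colour, so Fᵒ lies in every large complete (s+1)-partite graph.  An Fᵒ-extremal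
-- graph G has at least as many edges as the Turán graph with s parts, which contains no F.  Erdős–Stone and a
-- stability argument then give a set of |Fᵒ| + 1 vertices of G with more than n/2 common neighbours.  A vertex of low
-- degree could be reattached to these common neighbours, gaining edges and staying Fᵒ-free; hence all degrees of G
-- exceed n/2 by a constant, any two vertices have many common neighbours, and a copy of F in G extends greedily to
-- a copy of Fᵒ.  So Fᵒ-extremal graphs are F-free.  Since F ⊆ Fᵒ, the two extremal families coincide.

open import Defs renaming (sym to adj-sym; irrefl to adj-irrefl)
open import Data.Bool using (Bool; true; false; T; _∧_; _∨_; not; if_then_else_)
open import Data.Bool.Properties using (T-≡; T-irrelevant; T?; not-involutive) renaming (_≟_ to _Bool≟_)
open import Data.Empty using (⊥)
open import Data.Fin using (Fin; zero; suc; toℕ; fromℕ<; inject≤; combine; remQuot; join; splitAt; _↑ˡ_; finToFun; funToFin)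
open import Data.Fin.Properties
  using ( _≟_; any?; all?; ¬∀⟶∃¬; pigeonhole; toℕ-injective; toℕ-fromℕ<; fromℕ<-toℕ; toℕ<n; toℕ-combine; toℕ-inject≤
        ; splitAt-join; remQuot-combine; combine-injective; inject≤-injective; ↑ˡ-injective; finToFun-funToFin )
  renaming (<⇒≢ to Fin-<⇒≢)
open import Data.List using (List; []; _∷_; allFin; map; tabulate)
open import Data.List.Properties using (map-tabulate)
open import Data.Nat using (ℕ; zero; suc; _+_; _*_; _∸_; _^_; _≤_; _<_; z≤n; s≤s; s≤s⁻¹; _≤?_; _<?_; _<ᵇ_; >-nonZero)
open import Data.Nat.DivMod using (_/_; _%_; _mod_; m%n<n; m<n⇒m%n≡m; [m+n]%n≡m%n; m≡m%n+[m/n]*n)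
import Data.Nat.ListAction as List
open import Data.Nat.Properties hiding (_≟_; suc-injective)
open import Data.Nat.Properties using () renaming (suc-injective to ℕ-suc-injective; _≟_ to _ℕ≟_)
open import Data.Nat.Tactic.RingSolver using (solve)
open import Data.Product using (Σ; _×_; _,_; proj₁; proj₂; ∃)
open import Data.Sum using (_⊎_; inj₁; inj₂)
open import Data.Sum.Properties using (inj₁-injective; inj₂-injective)
open import Function using (_∘_; case_of_)
open import Function.Bundles using (_⇔_; Equivalence; mk⇔)
open import Function.Definitions using (Injective)
open import Relation.Binary using (tri<; tri≈; tri>)
open import Relation.Binary.PropositionalEquality
open import Relation.Nullary using (¬_; Dec; yes; no; does; contradiction)
open import Relation.Nullary.Decidable using (_×-dec_; _→-dec_; ¬?; dec-true; map′)
open import Algebra.Properties.CommutativeSemigroup *-commutativeSemigroup using (x∙yz≈y∙xz)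
open import Algebra.Properties.Semiring.Sum +-*-semiring
  using (sum; sum-cong-≗; ∑-distrib-+; ∑-comm; *-distribˡ-sum)

-- All counting is done in the complement: `D` counts ordered non-adjacent pairs, diagonal included,
-- so `2 * edgeCount G + D G full ≡ n * n`, and having as many edges as the Turán graph becomes
-- `s * D G full ≤ n * (n + s)`, free of floors and subtraction. The global structure of an extremal
-- graph is never determined. One part of one large complete `s`-partite subgraph suffices: its
-- vertices typically miss about n/s vertices, and `3 ≤ s` leaves a common neighbourhood above n/2
-- with room for all the errors. The obstacle is that an edge count says nothing about a single
-- vertex: a few vertices may have small degree, and a path of the balloon could get stuck there.
-- Reattaching such a vertex keeps `n` fixed, so maximality applies directly. The extra vertex in
-- |Fᵒ| + 1 is the stand-in: a copy of Fᵒ cannot occupy all of them, so one is free to replace the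
-- reattached vertex. Containment of a pattern is never decided. Existence statements depending on
-- it are double negated, which is enough because the goals they serve are negations or inequalities
-- of numbers.

private variable
  n t : ℕ

-- Linear arithmetic by certificate: b − a = (y − x) + d.
≤-cert : ∀ {x y a b} d → x ≤ y → a + (y + d) ≡ b + x → a ≤ b
≤-cert {x} {y} {a} {b} d x≤y eq = +-cancelʳ-≤ x a b (begin
  a + x       ≤⟨ +-monoʳ-≤ a (≤-trans x≤y (m≤m+n y d)) ⟩
  a + (y + d) ≡⟨ eq ⟩
  b + x       ∎)
  where open ≤-Reasoning

-- Finite sums and subsets of `Fin n`

abstract
  ∑ : (Fin n → ℕ) → ℕ
  ∑ = sum

  ∑-cong : {f g : Fin n → ℕ} → (∀ i → f i ≡ g i) → ∑ f ≡ ∑ g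
  ∑-cong = sum-cong-≗

  ∑-+ : ∀ (f g : Fin n → ℕ) → ∑ (λ i → f i + g i) ≡ ∑ f + ∑ g
  ∑-+ = ∑-distrib-+

  ∑-swap : ∀ {m} (f : Fin m → Fin n → ℕ) → ∑ (λ i → ∑ (f i)) ≡ ∑ (λ j → ∑ (λ i → f i j))
  ∑-swap = ∑-comm

  ∑-* : ∀ c (f : Fin n → ℕ) → ∑ (λ i → c * f i) ≡ c * ∑ f
  ∑-* c f = sym (*-distribˡ-sum c f)

  ∑-mono : {f g : Fin n → ℕ} → (∀ i → f i ≤ g i) → ∑ f ≤ ∑ g
  ∑-mono {zero}  f≤g = z≤n
  ∑-mono {suc n} f≤g = +-mono-≤ (f≤g zero) (∑-mono (f≤g ∘ suc))

  ∑-const : ∀ n c → ∑ {n} (λ _ → c) ≡ n * c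
  ∑-const zero    c = refl
  ∑-const (suc n) c = cong (c +_) (∑-const n c)

  term≤∑ : ∀ (f : Fin n → ℕ) i → f i ≤ ∑ f
  term≤∑ f zero    = m≤m+n _ _
  term≤∑ f (suc i) = ≤-trans (term≤∑ (f ∘ suc) i) (m≤n+m _ _)

  0<∑⇒0<term : ∀ (f : Fin n → ℕ) → 0 < ∑ f → ∃ λ i → 0 < f i
  0<∑⇒0<term {suc n} f 0<∑ with f zero in eq
  ... | suc _ = zero , subst (0 <_) (sym eq) (s≤s z≤n)
  ... | zero with i , 0<fi ← 0<∑⇒0<term (f ∘ suc) 0<∑ = suc i , 0<fi

  ∑-append : ∀ m {n} (g : ℕ → ℕ) → ∑ {m + n} (g ∘ toℕ) ≡ ∑ {m} (g ∘ toℕ) + ∑ {n} (λ j → g (m + toℕ j))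
  ∑-append zero    g = refl
  ∑-append (suc m) g = trans (cong (g 0 +_) (∑-append m (g ∘ suc))) (sym (+-assoc (g 0) _ _))

  list-sum : ∀ (f : Fin n → ℕ) → List.sum (map f (allFin n)) ≡ ∑ f
  list-sum f = trans (cong List.sum (map-tabulate (λ i → i) f)) (sum-tabulate f)
    where
    sum-tabulate : ∀ {n} (f : Fin n → ℕ) → List.sum (tabulate f) ≡ ∑ f
    sum-tabulate {zero}  f = refl
    sum-tabulate {suc n} f = cong (f zero +_) (sum-tabulate (f ∘ suc))

𝟙 : Bool → ℕ
𝟙 true  = 1
𝟙 false = 0

𝟙≤1 : ∀ b → 𝟙 b ≤ 1
𝟙≤1 true  = ≤-refl
𝟙≤1 false = z≤n

_==_ : Fin n → Fin n → Bool
i == j = does (i ≟ j)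

==-refl : (i : Fin n) → (i == i) ≡ true
==-refl i with i ≟ i
... | yes _ = refl
... | no  q = contradiction refl q

abstract
  ∑-δ : ∀ (f : Fin n → ℕ) v → ∑ (λ i → 𝟙 (i == v) * f i) ≡ f v
  ∑-δ {suc n} f zero    = trans (cong₂ _+_ (+-identityʳ (f zero)) (trans (∑-const n 0) (*-zeroʳ n))) (+-identityʳ _)
  ∑-δ {suc n} f (suc v) = ∑-δ (f ∘ suc) v

Subset : ℕ → Set
Subset n = Fin n → Bool

_∈_ : Fin n → Subset n → Set
x ∈ A = A x ≡ true

_⊆_ : Subset n → Subset n → Set
A ⊆ B = ∀ x → x ∈ A → x ∈ B

∑∈ : Subset n → (Fin n → ℕ) → ℕ
∑∈ A f = ∑ λ x → 𝟙 (A x) * f x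

# : Subset n → ℕ
# A = ∑∈ A (λ _ → 1)

∑∈-mono : ∀ (A : Subset n) {f g} → (∀ x → x ∈ A → f x ≤ g x) → ∑∈ A f ≤ ∑∈ A g
∑∈-mono A {f} {g} f≤g = ∑-mono pointwise
  where
  pointwise : ∀ x → 𝟙 (A x) * f x ≤ 𝟙 (A x) * g x
  pointwise x with A x in eq
  ... | true  = *-monoʳ-≤ 1 (f≤g x eq)
  ... | false = z≤n

∑∈-cong : ∀ (A : Subset n) {f g} → (∀ x → x ∈ A → f x ≡ g x) → ∑∈ A f ≡ ∑∈ A g
∑∈-cong A {f} {g} f≡g = ∑-cong pointwise
  where
  pointwise : ∀ x → 𝟙 (A x) * f x ≡ 𝟙 (A x) * g x
  pointwise x with A x in eq
  ... | true  = cong (1 *_) (f≡g x eq)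
  ... | false = refl

∑∈-⊆ : ∀ {A B : Subset n} f → A ⊆ B → ∑∈ A f ≤ ∑∈ B f
∑∈-⊆ {A = A} {B} f A⊆B = ∑-mono pointwise
  where
  pointwise : ∀ x → 𝟙 (A x) * f x ≤ 𝟙 (B x) * f x
  pointwise x with A x in eq
  ... | true rewrite A⊆B x eq = ≤-refl
  ... | false = z≤n

∑∈-+ : ∀ (A : Subset n) f g → ∑∈ A (λ x → f x + g x) ≡ ∑∈ A f + ∑∈ A g
∑∈-+ A f g = trans (∑-cong λ x → *-distribˡ-+ (𝟙 (A x)) (f x) (g x)) (∑-+ _ _)

∑∈-* : ∀ (A : Subset n) c f → ∑∈ A (λ x → c * f x) ≡ c * ∑∈ A f
∑∈-* A c f = trans (∑-cong λ x → swap (𝟙 (A x)) (f x)) (∑-* c _)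
  where
  swap : ∀ a b → a * (c * b) ≡ c * (a * b)
  swap a b = solve (a ∷ b ∷ c ∷ [])

∑∈-const : ∀ (A : Subset n) c → ∑∈ A (λ _ → c) ≡ c * # A
∑∈-const A c = trans (∑-cong λ x → cong (𝟙 (A x) *_) (sym (*-identityʳ c))) (∑∈-* A c _)

∑∈-∑ : ∀ {m} (A : Subset n) (f : Fin n → Fin m → ℕ) →
       ∑∈ A (λ x → ∑ (f x)) ≡ ∑ λ i → ∑∈ A (λ x → f x i)
∑∈-∑ A f = trans (∑-cong λ x → sym (∑-* (𝟙 (A x)) (f x))) (∑-swap _)

∑∈-comm : ∀ (A B : Subset n) (f : Fin n → Fin n → ℕ) → ∑∈ A (λ x → ∑∈ B (λ y → f x y)) ≡ ∑∈ B (λ y → ∑∈ A (λ x → f x y))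
∑∈-comm A B f = trans (∑∈-∑ A (λ x y → 𝟙 (B y) * f x y)) (∑-cong λ y →
  trans (∑-cong λ x → swap (𝟙 (A x)) (𝟙 (B y)) (f x y)) (∑-* (𝟙 (B y)) _))
  where
  swap : ∀ a b c → a * (b * c) ≡ b * (a * c)
  swap a b c = solve (a ∷ b ∷ c ∷ [])

∑∈-≤const : ∀ (A : Subset n) {f} c → (∀ x → x ∈ A → f x ≤ c) → ∑∈ A f ≤ c * # A
∑∈-≤const A c f≤c = ≤-trans (∑∈-mono A f≤c) (≤-reflexive (∑∈-const A c))

full : Subset n
full _ = true

#full : ∀ n → # (full {n}) ≡ n
#full n = trans (∑-const n 1) (*-identityʳ n)

_∖_ : Subset n → Fin n → Subset n
(A ∖ v) x = A x ∧ not (x == v)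

∖-⊆ : ∀ (A : Subset n) v → (A ∖ v) ⊆ A
∖-⊆ A v x e with A x
... | true = refl

∖-≢ : ∀ (A : Subset n) v x → x ∈ (A ∖ v) → x ≢ v
∖-≢ A v x e refl with A x | e
... | true | e′ rewrite ==-refl x with () ← e′

∖-∈ : ∀ (A : Subset n) v x → x ∈ A → x ≢ v → x ∈ (A ∖ v)
∖-∈ A v x x∈ x≢v rewrite x∈ with x ≟ v
... | yes p = contradiction p x≢v
... | no _  = refl

𝟙-∖ : ∀ (A : Subset n) v → v ∈ A → ∀ x → 𝟙 (A x) ≡ 𝟙 ((A ∖ v) x) + 𝟙 (x == v)
𝟙-∖ A v v∈ x with x ≟ v
... | yes refl rewrite v∈ = refl
... | no _ with A x
...   | true  = refl
...   | false = refl

∑∈-∖ : ∀ (A : Subset n) v f → v ∈ A → ∑∈ A f ≡ ∑∈ (A ∖ v) f + f v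
∑∈-∖ A v f v∈ = trans (∑-cong λ x → trans (cong (_* f x) (𝟙-∖ A v v∈ x)) (*-distribʳ-+ (f x) (𝟙 ((A ∖ v) x)) _))
  (trans (∑-+ _ _) (cong (∑∈ (A ∖ v) f +_) (∑-δ f v)))

#-∖ : ∀ (A : Subset n) v → v ∈ A → # A ≡ suc (# (A ∖ v))
#-∖ A v v∈ = trans (∑∈-∖ A v _ v∈) (+-comm _ 1)

∈⇒0<# : ∀ (A : Subset n) v → v ∈ A → 0 < # A
∈⇒0<# A v v∈ = subst (0 <_) (sym (#-∖ A v v∈)) (s≤s z≤n)

0<#⇒∈ : ∀ (A : Subset n) → 0 < # A → ∃ λ x → x ∈ A
0<#⇒∈ A 0<# with x , 0<x ← 0<∑⇒0<term _ 0<# with A x in eq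
... | true = x , eq

subset-of-size : ∀ (A : Subset n) → t ≤ # A → ∃ λ B → B ⊆ A × # B ≡ t
subset-of-size {n} {t} A t≤ = shrink (# A ∸ t) A (sym (m∸n+n≡m t≤))
  where
  shrink : ∀ d (A : Subset n) → # A ≡ d + t → ∃ λ B → B ⊆ A × # B ≡ t
  shrink zero    A eq = A , (λ _ p → p) , eq
  shrink (suc d) A eq with v , v∈ ← 0<#⇒∈ A (subst (0 <_) (sym eq) (s≤s z≤n))
    with B , B⊆ , #B ← shrink d (A ∖ v) (ℕ-suc-injective (trans (sym (#-∖ A v v∈)) eq))
    = B , (λ x → ∖-⊆ A v x ∘ B⊆ x) , #B

enumerate : ∀ (A : Subset n) → t ≤ # A → Σ (Fin t → Fin n) λ e → Injective _≡_ _≡_ e × (∀ i → e i ∈ A)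
enumerate {t = zero}  A _ = (λ ()) , (λ {i} → case i of λ ()) , λ ()
enumerate {n} {suc t} A t< with v , v∈ ← 0<#⇒∈ A (≤-trans (s≤s z≤n) t<)
  with e , e-inj , e∈ ← enumerate (A ∖ v) (s≤s⁻¹ (≤-trans t< (≤-reflexive (#-∖ A v v∈)))) = e′ , e′-inj , e′∈
  where
  e′ : Fin (suc t) → Fin n
  e′ zero    = v
  e′ (suc i) = e i
  e′-inj : Injective _≡_ _≡_ e′
  e′-inj {zero}  {zero}  _  = refl
  e′-inj {zero}  {suc j} eq = contradiction (sym eq) (∖-≢ A v _ (e∈ j))
  e′-inj {suc i} {zero}  eq = contradiction eq (∖-≢ A v _ (e∈ i))
  e′-inj {suc i} {suc j} eq = cong suc (e-inj eq)
  e′∈ : ∀ i → e′ i ∈ A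
  e′∈ zero    = v∈
  e′∈ (suc i) = ∖-⊆ A v _ (e∈ i)

_∩_ : Subset n → Subset n → Subset n
(A ∩ B) x = A x ∧ B x

∁ : Subset n → Subset n
∁ A x = not (A x)

∩-⊆ˡ : ∀ (A B : Subset n) → (A ∩ B) ⊆ A
∩-⊆ˡ A B x e with A x
... | true = refl

∩-⊆ʳ : ∀ (A B : Subset n) → (A ∩ B) ⊆ B
∩-⊆ʳ A B x e with A x
... | true = e

∩-∈ : ∀ (A B : Subset n) {x} → x ∈ A → x ∈ B → x ∈ (A ∩ B)
∩-∈ A B {x} p q rewrite p = q

∑∈-split : ∀ (A B : Subset n) f → ∑∈ A f ≡ ∑∈ (A ∩ B) f + ∑∈ (A ∩ ∁ B) f
∑∈-split A B f = trans (∑-cong pointwise) (∑-+ _ _)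
  where
  pointwise : ∀ x → 𝟙 (A x) * f x ≡ 𝟙 (A x ∧ B x) * f x + 𝟙 (A x ∧ not (B x)) * f x
  pointwise x with A x | B x
  ... | true  | true  = sym (+-identityʳ _)
  ... | true  | false = refl
  ... | false | _     = refl

-- Split S according to its relation to one element of Q at a time and keep the larger half.
homogeneous-subset : ∀ (r : Fin n → Fin n → Bool) N (Q S : Subset n) → # Q ≤ N → 2 ^ N * t ≤ # S →
  ∃ λ S′ → S′ ⊆ S × t ≤ # S′ × (∀ x y z → x ∈ S′ → y ∈ S′ → z ∈ Q → r x z ≡ r y z)
homogeneous-subset {t = t} r N Q S #Q≤ big with 0 <? # Q
homogeneous-subset {t = t} r N Q S #Q≤ big | no Q-empty =
  S , (λ _ p → p) , ≤-trans (m≤n*m t (2 ^ N) {{m^n≢0 2 N}}) big ,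
  λ x y z _ _ z∈ → contradiction (∈⇒0<# Q z z∈) Q-empty
homogeneous-subset r zero Q S #Q≤ big | yes Q≢∅ = contradiction (≤-trans Q≢∅ #Q≤) λ ()
homogeneous-subset {n} {t} r (suc N) Q S #Q≤ big | yes Q≢∅ with v , v∈ ← 0<#⇒∈ Q Q≢∅ = result
  where
  R : Subset n
  R x = r x v
  Half : Subset n → Set
  Half H = 2 ^ N * t ≤ # H
  larger : Half (S ∩ R) ⊎ Half (S ∩ ∁ R)
  larger with 2 ^ N * t ≤? # (S ∩ R) | 2 ^ N * t ≤? # (S ∩ ∁ R)
  ... | yes p | _     = inj₁ p
  ... | no  _ | yes q = inj₂ q
  ... | no  p | no  q = contradiction big (<⇒≱ (begin-strict
    # S                          ≡⟨ ∑∈-split S R _ ⟩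
    # (S ∩ R) + # (S ∩ ∁ R)      <⟨ +-mono-< (≰⇒> p) (≰⇒> q) ⟩
    2 ^ N * t + 2 ^ N * t        ≡⟨ double (2 ^ N) ⟩
    2 ^ suc N * t                ∎))
    where
    open ≤-Reasoning
    double : ∀ m → m * t + m * t ≡ (m + (m + 0)) * t
    double m = solve (m ∷ t ∷ [])
  conclude : ∀ H → H ⊆ S → Half H → (∀ x y → x ∈ H → y ∈ H → r x v ≡ r y v) →
    ∃ λ S′ → S′ ⊆ S × t ≤ # S′ × (∀ x y z → x ∈ S′ → y ∈ S′ → z ∈ Q → r x z ≡ r y z)
  conclude H H⊆ half hom
    with S′ , S′⊆ , t≤ , hom′ ← homogeneous-subset r N (Q ∖ v) H
           (s≤s⁻¹ (≤-trans (≤-reflexive (sym (#-∖ Q v v∈))) #Q≤)) half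
    = S′ , (λ x → H⊆ x ∘ S′⊆ x) , t≤ , final
    where
    final : ∀ x y z → x ∈ S′ → y ∈ S′ → z ∈ Q → r x z ≡ r y z
    final x y z x∈ y∈ z∈ with z ≟ v
    ... | yes refl = hom x y (S′⊆ x x∈) (S′⊆ y y∈)
    ... | no z≢v   = hom′ x y z x∈ y∈ (∖-∈ Q v z z∈ z≢v)
  not-false : ∀ {b} → not b ≡ true → b ≡ false
  not-false {false} _ = refl
  result : ∃ λ S′ → S′ ⊆ S × t ≤ # S′ × (∀ x y z → x ∈ S′ → y ∈ S′ → z ∈ Q → r x z ≡ r y z)
  result with larger
  ... | inj₁ p = conclude (S ∩ R) (∩-⊆ˡ S R) p λ x y x∈ y∈ → trans (∩-⊆ʳ S R x x∈) (sym (∩-⊆ʳ S R y y∈))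
  ... | inj₂ q = conclude (S ∩ ∁ R) (∩-⊆ˡ S (∁ R)) q λ x y x∈ y∈ →
    trans (not-false (∩-⊆ʳ S (∁ R) x x∈)) (sym (not-false (∩-⊆ʳ S (∁ R) y y∈)))

-- Complete multipartite subgraphs of dense graphs

does-sound : ∀ {ℓ} {A : Set ℓ} (A? : Dec A) → does A? ≡ true → A
does-sound (yes a) _ = a

module _ (G : SimpleGraph n) where

  β : Fin n → Fin n → ℕ
  β x y = 𝟙 (not (adj G x y))

  β-sym : ∀ x y → β x y ≡ β y x
  β-sym x y = cong (𝟙 ∘ not) (adj-sym G x y)

  β-diag : ∀ x → β x x ≡ 1
  β-diag x = cong (𝟙 ∘ not) (adj-irrefl G x)

  -- Non-neighbours of z in A; z itself is counted when it lies in A.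
  nd : Subset n → Fin n → ℕ
  nd A z = ∑∈ A (β z)

  D : Subset n → ℕ
  D A = ∑∈ A (nd A)

  D-∖ : ∀ A v → v ∈ A → D A + 1 ≡ D (A ∖ v) + 2 * nd A v
  D-∖ A v v∈ = trans (cong (_+ 1) eq₁) (trans (regroup (D (A ∖ v)) (nd (A ∖ v) v)) (cong (λ m → D (A ∖ v) + 2 * m) (sym eq₂)))
    where
    eq₂ : nd A v ≡ nd (A ∖ v) v + 1
    eq₂ = trans (∑∈-∖ A v (β v) v∈) (cong (nd (A ∖ v) v +_) (β-diag v))
    eq₃ : ∑∈ (A ∖ v) (nd A) ≡ D (A ∖ v) + nd (A ∖ v) v
    eq₃ = begin
      ∑∈ (A ∖ v) (nd A)                        ≡⟨ ∑-cong (λ x → cong (𝟙 ((A ∖ v) x) *_) (∑∈-∖ A v (β x) v∈)) ⟩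
      ∑∈ (A ∖ v) (λ x → nd (A ∖ v) x + β x v)  ≡⟨ ∑∈-+ (A ∖ v) (nd (A ∖ v)) (λ x → β x v) ⟩
      D (A ∖ v) + ∑∈ (A ∖ v) (λ x → β x v)     ≡⟨ cong (D (A ∖ v) +_) (∑-cong λ x → cong (𝟙 ((A ∖ v) x) *_) (β-sym x v)) ⟩
      D (A ∖ v) + nd (A ∖ v) v                 ∎
      where open ≡-Reasoning
    eq₁ : D A ≡ D (A ∖ v) + nd (A ∖ v) v + (nd (A ∖ v) v + 1)
    eq₁ = trans (∑∈-∖ A v (nd A) v∈) (cong₂ _+_ eq₃ eq₂)
    regroup : ∀ d m → d + m + (m + 1) + 1 ≡ d + 2 * (m + 1)
    regroup d m = solve (d ∷ m ∷ [])

  -- A minimum degree condition in the complement: the summand `q` cancels the vertex itself, so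
  -- each vertex of `A` has at most (r/q)|A| non-neighbours in `A` other than itself.
  MinDegree : ℕ → ℕ → Subset n → Set
  MinDegree q r A = ∀ v → v ∈ A → q * nd A v ≤ r * # A + q

  -- Deleting a vertex with too many non-neighbours does not increase q D(A) − r |A|².
  prune : ∀ q r X A → q * D A + X ≤ r * (# A * # A) →
    ∃ λ B → q * D B + X ≤ r * (# B * # B) × MinDegree q r B
  prune q r X A = go (# A) A refl
    where
    go : ∀ m A → # A ≡ m → q * D A + X ≤ r * (# A * # A) →
      ∃ λ B → q * D B + X ≤ r * (# B * # B) × MinDegree q r B
    go m A #A dense with any? (λ v → (A v Bool≟ true) ×-dec (r * # A + q <? q * nd A v))
    go m A #A dense | no ok =
      A , dense , λ v v∈ → ≮⇒≥ λ low → ok (v , v∈ , low)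
    go zero A #A dense | yes (v , v∈ , _) = contradiction (subst (0 <_) #A (∈⇒0<# A v v∈)) λ ()
    go (suc m) A #A dense | yes (v , v∈ , low) = go m (A ∖ v) #A∖v
      (subst (λ k → q * D (A ∖ v) + X ≤ r * (k * k)) (sym #A∖v)
        (≤-cert (r + q)
          (+-mono-≤ (+-mono-≤ (subst (λ k → q * D A + X ≤ r * (k * k)) #A dense)
                              (*-monoʳ-≤ 2 (<⇒≤ (subst (λ k → r * k + q < q * nd A v) #A low))))
                    (≤-reflexive (cong (q *_) (sym (D-∖ A v v∈)))))
          (identity (D A) (D (A ∖ v)) (nd A v))))
      where
      #A∖v : # (A ∖ v) ≡ m
      #A∖v = ℕ-suc-injective (trans (sym (#-∖ A v v∈)) #A)
      identity : ∀ d d′ k →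
        q * d′ + X + (r * (suc m * suc m) + 2 * (q * k) + q * (d + 1) + (r + q)) ≡
        r * (m * m) + (q * d + X + 2 * (r * suc m + q) + q * (d′ + 2 * k))
      identity d d′ k = solve (q ∷ r ∷ X ∷ m ∷ d ∷ d′ ∷ k ∷ [])

  -- Disjointness of the parts is implied by `complete`: a vertex common to two parts would be
  -- adjacent to itself.
  record CompletePartite (W : Subset n) (j t : ℕ) : Set where
    field
      part     : Fin j → Subset n
      part⊆    : ∀ a → part a ⊆ W
      #part    : ∀ a → # (part a) ≡ t
      complete : ∀ {a b} x y → a ≢ b → x ∈ part a → y ∈ part b → adj G x y ≡ true

  module _ {W : Subset n} {j t : ℕ} (K : CompletePartite W j t) where
    open CompletePartite K

    missing : Fin j → Fin n → ℕ
    missing a x = ∑∈ (part a) λ z → β z x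

    #neighbours : ∀ a x → # (part a ∩ adj G x) + missing a x ≡ t
    #neighbours a x = trans (cong (# (part a ∩ adj G x) +_) (∑-cong pointwise))
                            (trans (sym (∑∈-split (part a) (adj G x) _)) (#part a))
      where
      pointwise : ∀ z → 𝟙 (part a z) * β z x ≡ 𝟙 (part a z ∧ not (adj G x z)) * 1
      pointwise z rewrite adj-sym G z x with part a z
      ... | true  = trans (*-identityˡ _) (sym (*-identityʳ _))
      ... | false = refl

    union : Subset n
    union x = does (any? λ a → part a x Bool≟ true)

    #union : # union ≤ j * t
    #union = begin
      # union                                     ≤⟨ ∑-mono pointwise ⟩
      ∑ (λ x → ∑ λ a → 𝟙 (part a x) * 1)          ≡⟨ ∑-swap _ ⟩
      ∑ (λ a → # (part a))                        ≡⟨ ∑-cong #part ⟩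
      ∑ {j} (λ _ → t)                             ≡⟨ ∑-const j t ⟩
      j * t                                       ∎
      where
      open ≤-Reasoning
      pointwise : ∀ x → 𝟙 (union x) * 1 ≤ ∑ λ a → 𝟙 (part a x) * 1
      pointwise x with any? (λ a → part a x Bool≟ true)
      ... | no _ = z≤n
      ... | yes (a , x∈) = ≤-trans (≤-reflexive (cong (λ b → 𝟙 b * 1) (sym x∈)))
                                   (term≤∑ (λ a → 𝟙 (part a x) * 1) a)

    module _ (t′ : ℕ) where

      Full : Fin n → Set
      Full x = ∀ a → missing a x + t′ ≤ t

      abstract
        full? : ∀ x → Dec (Full x)
        full? x = all? λ a → missing a x + t′ ≤? t

      fullSet : Subset n
      fullSet x = W x ∧ does (full? x)

      sparse : Fin j → Subset n
      sparse a x = does (t <? missing a x + t′)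

      -- The union of the parts has at most `j * t` vertices, so there are at most 2^(jt) adjacency
      -- patterns towards it, and some `t′` vertices of `fullSet` share one. Any one of them, `x₀`,
      -- then speaks for all: each old part shrinks to `t′` neighbours of `x₀`.
      extend : 1 ≤ t′ → 2 ^ (j * t) * t′ ≤ # fullSet → CompletePartite W (suc j) t′
      extend 1≤t′ big
        with S , S⊆ , t′≤#S , hom ← homogeneous-subset (adj G) (j * t) union fullSet #union big
        = record
        { part     = new
        ; part⊆    = new⊆
        ; #part    = #new
        ; complete = new-complete
        }
        where
        exact = subset-of-size S t′≤#S
        S′ = proj₁ exact
        S′⊆ = proj₁ (proj₂ exact)
        #S′ = proj₂ (proj₂ exact)
        centre = 0<#⇒∈ S′ (subst (0 <_) (sym #S′) 1≤t′)
        x₀ = proj₁ centre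
        x₀∈S = S′⊆ x₀ (proj₂ centre)
        shrunk : ∀ a → ∃ λ B → B ⊆ (part a ∩ adj G x₀) × # B ≡ t′
        shrunk a = subset-of-size (part a ∩ adj G x₀) (+-cancelʳ-≤ (missing a x₀) t′ _ (begin
          t′ + missing a x₀                       ≡⟨ +-comm t′ _ ⟩
          missing a x₀ + t′                       ≤⟨ does-sound (full? x₀) (∩-⊆ʳ W (does ∘ full?) x₀ (S⊆ x₀ x₀∈S)) a ⟩
          t                                       ≡⟨ #neighbours a x₀ ⟨
          # (part a ∩ adj G x₀) + missing a x₀    ∎))
          where open ≤-Reasoning
        new : Fin (suc j) → Subset n
        new zero    = S′
        new (suc a) = proj₁ (shrunk a)
        new⊆part : ∀ a → new (suc a) ⊆ part a
        new⊆part a x x∈ = ∩-⊆ˡ (part a) (adj G x₀) x (proj₁ (proj₂ (shrunk a)) x x∈)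
        new⊆ : ∀ a → new a ⊆ W
        new⊆ zero    x x∈ = ∩-⊆ˡ W (does ∘ full?) x (S⊆ x (S′⊆ x x∈))
        new⊆ (suc a) x x∈ = part⊆ a x (new⊆part a x x∈)
        #new : ∀ a → # (new a) ≡ t′
        #new zero    = #S′
        #new (suc a) = proj₂ (proj₂ (shrunk a))
        joined : ∀ a x y → x ∈ S′ → y ∈ new (suc a) → adj G x y ≡ true
        joined a x y x∈ y∈ = trans
          (hom x x₀ y (S′⊆ x x∈) x₀∈S (dec-true (any? λ a → part a y Bool≟ true) (a , new⊆part a y y∈)))
          (∩-⊆ʳ (part a) (adj G x₀) y (proj₁ (proj₂ (shrunk a)) y y∈))
        new-complete : ∀ {a b} x y → a ≢ b → x ∈ new a → y ∈ new b → adj G x y ≡ true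
        new-complete {zero}  {zero}  x y a≢b _  _  = contradiction refl a≢b
        new-complete {zero}  {suc b} x y a≢b x∈ y∈ = joined b x y x∈ y∈
        new-complete {suc a} {zero}  x y a≢b x∈ y∈ = trans (adj-sym G x y) (joined a y x y∈ x∈)
        new-complete {suc a} {suc b} x y a≢b x∈ y∈ =
          complete x y (a≢b ∘ cong suc) (new⊆part a x x∈) (new⊆part b y y∈)

      -- Non-adjacent pairs between a part and a vertex with at least `t′` neighbours in that part.
      -- Near a Turán graph a vertex is sparse to its own part and joined to almost all of the
      -- others, so these pairs are the defects.
      residual : ℕ
      residual = ∑ λ a → ∑∈ (W ∩ ∁ (sparse a)) (missing a)

      totalMissing : ℕ
      totalMissing = ∑ λ a → ∑∈ W (missing a)

      -- A vertex of W outside fullSet misses more than t − t′ vertices of one part where it is sparse.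
      residual-bound : residual + t * # W ≤ totalMissing + t′ * # W + t * # fullSet
      residual-bound = begin
        residual + t * # W
          ≡⟨ cong₂ _+_ (trans (∑-swap _) (∑-cong λ x → trans (∑-cong λ a → split a x) (∑-* (𝟙 (W x)) _)))
                       (sym (∑∈-const W t)) ⟩
        ∑∈ W rest + ∑∈ W (λ _ → t)                                   ≡⟨ ∑∈-+ W rest _ ⟨
        ∑∈ W (λ x → rest x + t)                                      ≤⟨ ∑∈-mono W pointwise ⟩
        ∑∈ W (λ x → all x + t′ + t * 𝟙 (does (full? x)))             ≡⟨ ∑∈-+ W _ _ ⟩
        ∑∈ W (λ x → all x + t′) + ∑∈ W (λ x → t * 𝟙 (does (full? x)))
          ≡⟨ cong₂ _+_ (trans (∑∈-+ W all _) (cong₂ _+_ (∑∈-∑ W (λ x a → missing a x)) (∑∈-const W t′)))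
                       (trans (∑∈-* W t _) (cong (t *_) (∑-cong λ x → full-𝟙 (W x) (does (full? x))))) ⟩
        totalMissing + t′ * # W + t * # fullSet                      ∎
        where
        open ≤-Reasoning
        rest all : Fin n → ℕ
        rest x = ∑ λ a → 𝟙 (not (sparse a x)) * missing a x
        all x = ∑ λ a → missing a x
        full-𝟙 : ∀ b c → 𝟙 b * 𝟙 c ≡ 𝟙 (b ∧ c) * 1
        full-𝟙 true  c = trans (*-identityˡ _) (sym (*-identityʳ _))
        full-𝟙 false c = refl
        split : ∀ a x → 𝟙 (W x ∧ not (sparse a x)) * missing a x ≡
                        𝟙 (W x) * (𝟙 (not (sparse a x)) * missing a x)
        split a x with W x
        ... | true  = sym (*-identityˡ _)
        ... | false = refl
        rest≤all : ∀ a x → 𝟙 (not (sparse a x)) * missing a x ≤ missing a x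
        rest≤all a x = ≤-trans (*-monoˡ-≤ (missing a x) (𝟙≤1 (not (sparse a x)))) (≤-reflexive (*-identityˡ _))
        pointwise : ∀ x → x ∈ W → rest x + t ≤ all x + t′ + t * 𝟙 (does (full? x))
        pointwise x _ with full? x
        ... | yes _ = +-mono-≤ (≤-trans (∑-mono λ a → rest≤all a x) (m≤m+n _ t′))
                               (≤-reflexive (sym (*-identityʳ t)))
        ... | no ¬full with a , few ← ¬∀⟶∃¬ j _ (λ a → missing a x + t′ ≤? t) ¬full = begin
          rest x + t                                     ≤⟨ +-monoʳ-≤ (rest x) (<⇒≤ (≰⇒> few)) ⟩
          rest x + (missing a x + t′)                    ≡⟨ +-assoc (rest x) _ t′ ⟨
          rest x + missing a x + t′                      ≡⟨ cong (λ m → rest x + m + t′) (sym (∑-δ (λ b → missing b x) a)) ⟩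
          rest x + ∑ (λ b → 𝟙 (b == a) * missing b x) + t′
            ≡⟨ cong (_+ t′) (sym (∑-+ _ _)) ⟩
          ∑ (λ b → 𝟙 (not (sparse b x)) * missing b x + 𝟙 (b == a) * missing b x) + t′
            ≤⟨ +-monoˡ-≤ t′ (∑-mono drop) ⟩
          all x + t′                                     ≤⟨ m≤m+n _ _ ⟩
          all x + t′ + t * 0                             ∎
          where
          drop : ∀ b → 𝟙 (not (sparse b x)) * missing b x + 𝟙 (b == a) * missing b x ≤ missing b x
          drop b with b ≟ a
          ... | no _ = ≤-trans (≤-reflexive (+-identityʳ _)) (rest≤all b x)
          ... | yes refl rewrite dec-true (t <? missing b x + t′) (≰⇒> few) = ≤-reflexive (*-identityˡ _)

    missing-swap : ∀ a (A : Subset n) → ∑∈ A (missing a) ≡ ∑∈ (part a) (λ z → nd A z)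
    missing-swap a A = ∑∈-comm A (part a) λ x z → β z x

    part-missing-bound : ∀ {q r} → MinDegree q r W → ∀ a → q * ∑∈ W (missing a) ≤ (r * # W + q) * t
    part-missing-bound {q} {r} deg a = begin
      q * ∑∈ W (missing a)              ≡⟨ cong (q *_) (missing-swap a W) ⟩
      q * ∑∈ (part a) (nd W)            ≡⟨ ∑∈-* (part a) q (nd W) ⟨
      ∑∈ (part a) (λ z → q * nd W z)    ≤⟨ ∑∈-≤const (part a) (r * # W + q) (λ z z∈ → deg z (part⊆ a z z∈)) ⟩
      (r * # W + q) * # (part a)        ≡⟨ cong ((r * # W + q) *_) (#part a) ⟩
      (r * # W + q) * t                 ∎
      where open ≤-Reasoning

    totalMissing-bound : ∀ {q r} → MinDegree q r W → ∀ t′ → q * totalMissing t′ ≤ j * ((r * # W + q) * t)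
    totalMissing-bound {q} {r} deg t′ = begin
      q * totalMissing t′                  ≡⟨ ∑-* q _ ⟨
      ∑ (λ a → q * ∑∈ W (missing a))       ≤⟨ ∑-mono (part-missing-bound {q} {r} deg) ⟩
      ∑ {j} (λ _ → (r * # W + q) * t)      ≡⟨ ∑-const j _ ⟩
      j * ((r * # W + q) * t)              ∎
      where open ≤-Reasoning

growthBound : ℕ → ℕ → ℕ → ℕ
growthBound j q t = 2 * (j * q) + 2 * (q * (2 ^ (j * (2 * (q * t))) * t))

-- Write T = 2qt for the old part size, w for |W| and g for the number of full vertices. As jr + 1 ≤
-- q, the total number of missing pairs is at most (1 - 1/q)wT + jT, while `residual-bound` makes it
-- at least wT - tw - Tg. Since T/q = 2t, half of the gain wT/q survives the loss tw, leaving w ≤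
-- 2jq + 2qg; so a large `W` forces enough full vertices for `extend`.
grow : ∀ {j q r} (G : SimpleGraph n) {W} → 1 ≤ t → 1 ≤ q → j * r < q → MinDegree G q r W →
  growthBound j q t < # W → CompletePartite G W j (2 * (q * t)) → CompletePartite G W (suc j) t
grow {n} {t} {j} {q} {r} G {W} 1≤t 1≤q jr<q deg large K with 2 ^ (j * (2 * (q * t))) * t ≤? # (fullSet G K t)
... | yes big = extend G K t 1≤t big
... | no few = contradiction (*-cancelˡ-≤ (q * t) {{m*n≢0 q t {{>-nonZero 1≤q}} {{>-nonZero 1≤t}}}} scaled) (<⇒≱ large′)
  where
  w = # W
  g = # (fullSet G K t)
  scaled : q * t * w ≤ q * t * (2 * (j * q) + 2 * (q * g))
  scaled = ≤-cert (residual G K t * q)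
    (+-mono-≤ (+-mono-≤ (*-monoˡ-≤ q (residual-bound G K t)) (totalMissing-bound G K {q} {r} deg t))
              (*-monoʳ-≤ (2 * (q * t) * w) jr<q))
    (identity (residual G K t) (totalMissing G K t) w g)
    where
    identity : ∀ R M w g →
      q * t * w + ((M + t * w + 2 * (q * t) * g) * q + j * ((r * w + q) * (2 * (q * t))) + 2 * (q * t) * w * q + R * q) ≡
      q * t * (2 * (j * q) + 2 * (q * g)) + ((R + 2 * (q * t) * w) * q + q * M + 2 * (q * t) * w * suc (j * r))
    identity R M w g = solve (R ∷ M ∷ w ∷ g ∷ q ∷ t ∷ j ∷ r ∷ [])
  large′ : 2 * (j * q) + 2 * (q * g) < w
  large′ = ≤-<-trans (+-monoʳ-≤ (2 * (j * q)) (*-monoʳ-≤ 2 (*-monoʳ-≤ q (<⇒≤ (≰⇒> few))))) large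

partiteBound : ℕ → ℕ → ℕ → ℕ
partiteBound zero    q t = 0
partiteBound (suc j) q t = growthBound j q t + partiteBound j q (2 * (q * t))

-- Each growth step shrinks the parts from 2qt to t, so the recursion requests the larger size in
-- advance.
find-partite : ∀ {q r} j (G : SimpleGraph n) {W} → 1 ≤ t → 1 ≤ q → (∀ i → i < j → i * r < q) → MinDegree G q r W →
  partiteBound j q t < # W → CompletePartite G W j t
find-partite zero G _ _ _ _ _ = record { part = λ () ; part⊆ = λ () ; #part = λ () ; complete = λ { {()} } }
find-partite {t = t} {q = q} {r = r} (suc j) G 1≤t 1≤q jr<q deg large =
  grow {r = r} G 1≤t 1≤q (jr<q j ≤-refl) deg (≤-<-trans (m≤m+n _ _) large)
    (find-partite {r = r} j G (≤-trans (*-mono-≤ 1≤q 1≤t) (m≤m+n _ _)) 1≤q (λ i i<j → jr<q i (m<n⇒m<1+n i<j)) deg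
      (≤-<-trans (m≤n+m _ (growthBound j q t)) large))

-- Erdős-Stone in complementary form, and numerical estimates

infixl 4 _⊕_
infixr 5 _⊛_

_⊕_ : ∀ {a b c d} → a ≤ b → c ≤ d → a + c ≤ b + d
_⊕_ = +-mono-≤

_⊛_ : ∀ c {a b} → a ≤ b → c * a ≤ c * b
_⊛_ = *-monoʳ-≤

square-cancel-≤ : ∀ {a b} → a * a ≤ b * b → a ≤ b
square-cancel-≤ a²≤b² = ≮⇒≥ λ b<a → <⇒≱ (*-mono-< b<a b<a) a²≤b²

-- Erdős–Stone, for the complement.
nonadjacency-lower-bound : ∀ s ν (G : SimpleGraph n) → 1 ≤ s → 1 ≤ t → (∀ W → ¬ CompletePartite G W (suc s) t) →
  ∀ W → (ν + 2) * partiteBound (suc s) (s * (ν + 2)) t < # W →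
  ν * (# W * # W) < s * (ν + 2) * D G W
nonadjacency-lower-bound {n} {t} s ν G 1≤s 1≤t no-K W large = ≰⇒> λ dense → impossible dense
  where
  w = # W
  q = s * (ν + 2)
  M = partiteBound (suc s) q t
  1≤q : 1 ≤ q
  1≤q = *-mono-≤ 1≤s (≤-trans (s≤s z≤n) (m≤n+m 2 ν))
  ratio : ∀ i → i < suc s → i * (ν + 1) < q
  ratio i i≤s = ≤-cert 0 ((ν + 1) ⊛ s≤s⁻¹ i≤s ⊕ 1≤s) (identity i)
    where
    identity : ∀ i → suc (i * (ν + 1)) + ((ν + 1) * s + s + 0) ≡ s * (ν + 2) + ((ν + 1) * i + 1)
    identity i = solve (i ∷ ν ∷ s ∷ [])
  raise : ∀ a b → a + b + (ν * b + 0) ≡ (ν + 1) * b + a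
  raise a b = solve (a ∷ b ∷ ν ∷ [])
  square : ∀ b → (ν + 1) * (b * b) + (ν * ν + 3 * ν + 3) * (b * b) ≡ (ν + 2) * b * ((ν + 2) * b)
  square b = solve (b ∷ ν ∷ [])
  impossible : ¬ (q * D G W ≤ ν * (w * w))
  impossible dense
    -- Raising the coefficient from ν to ν + 1 buys the surplus w². Pruning preserves it, so w² ≤ (ν
    -- + 1)|B|² and `B` stays large; the ratio (ν + 1)/(s(ν + 2)) is still below 1/s, which permits
    -- s + 1 parts.
    with B , denseB , deg ← prune G q (ν + 1) (w * w) W (≤-cert 0 dense (raise (q * D G W) (w * w)))
    = no-K B (find-partite {r = ν + 1} (suc s) G 1≤t 1≤q ratio deg
      (*-cancelˡ-< (ν + 2) M (# B) (<-≤-trans large (square-cancel-≤ (begin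
        w * w                                                      ≤⟨ m≤n+m _ (q * D G B) ⟩
        q * D G B + w * w                                          ≤⟨ denseB ⟩
        (ν + 1) * (# B * # B)                                      ≤⟨ m≤m+n _ _ ⟩
        (ν + 1) * (# B * # B) + (ν * ν + 3 * ν + 3) * (# B * # B)  ≡⟨ square (# B) ⟩
        (ν + 2) * # B * ((ν + 2) * # B)                            ∎)))))
    where open ≤-Reasoning

-- The ideal value of `b` is w/s. The errors 1/E, s/w and t′/t are each at most 1/40, so 39sb ≤ 42w,
-- and `3 ≤ s` turns this into 117b ≤ 42w. The bound 11/30 is a rounding of 42/117.
sparse-bound : ∀ {s E t t′ w b m} → 3 ≤ s → 40 ≤ E → 40 * s ≤ w → 40 * t′ ≤ t → 1 ≤ t →
  t * b ≤ m + t′ * b → s * E * m ≤ (suc E * w + s * E) * t → 30 * b ≤ 11 * w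
sparse-bound {s} {E} {t} {t′} {w} {b} {m} 3≤s 40≤E 40s≤w 40t′≤t 1≤t low few =
  *-cancelˡ-≤ 117 (≤-cert (27 * w) (30 ⊛ 117b≤42w) rescale)
  where
  rescale : 117 * (30 * b) + (30 * (42 * w) + 27 * w) ≡ 117 * (11 * w) + 30 * (117 * b)
  rescale = solve (b ∷ w ∷ [])
  1≤sE : 1 ≤ s * E
  1≤sE = *-mono-≤ (≤-trans (s≤s z≤n) 3≤s) (≤-trans (s≤s z≤n) 40≤E)
  117b≤42w : 117 * b ≤ 42 * w
  117b≤42w = *-cancelˡ-≤ (s * E * t) {{>-nonZero (*-mono-≤ 1≤sE 1≤t)}} (≤-cert 0
    ((40 * (s * E) * s) ⊛ low ⊕ (40 * s) ⊛ few ⊕ (s * E * s * b) ⊛ 40t′≤t ⊕ (s * w * t) ⊛ 40≤E ⊕ (s * E * t) ⊛ 40s≤w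
      ⊕ (39 * (s * E * t * b)) ⊛ 3≤s)
    identity)
    where
    identity : s * E * t * (117 * b) +
      (40 * (s * E) * s * (m + t′ * b) + 40 * s * ((suc E * w + s * E) * t) + s * E * s * b * t + s * w * t * E + s * E * t * w + 39 * (s * E * t * b) * s + 0) ≡
      s * E * t * (42 * w) +
      (40 * (s * E) * s * (t * b) + 40 * s * (s * E * m) + s * E * s * b * (40 * t′) + s * w * t * 40 + s * E * t * (40 * s) + 39 * (s * E * t * b) * 3)
    identity = solve (s ∷ E ∷ t ∷ t′ ∷ w ∷ b ∷ m ∷ [])

-- The main terms wt cancel, leaving R ≤ wt/E + st + t′w + tg. Each of these four errors is at most
-- wt/(8L), one for each hypothesis with the factor 8.
residual-bound′ : ∀ {s E L t t′ w g R M} → 1 ≤ s → 1 ≤ E → 8 * L ≤ E → 8 * (L * s) ≤ w → 8 * (L * t′) ≤ t → 8 * (L * g) ≤ w →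
  R + t * w ≤ M + t′ * w + t * g → s * E * M ≤ s * ((suc E * w + s * E) * t) → 2 * (L * R) ≤ w * t
residual-bound′ {s} {E} {L} {t} {t′} {w} {g} {R} {M} 1≤s 1≤E LE Lsw Lt′t Lgw count few =
  *-cancelˡ-≤ (4 * (s * E)) {{>-nonZero (≤-trans (*-mono-≤ 1≤s 1≤E) (m≤n*m _ 4))}} (≤-cert 0
    ((8 * L * (s * E)) ⊛ count ⊕ (8 * L) ⊛ few ⊕ (s * (w * t)) ⊛ LE ⊕ (s * E * t) ⊛ Lsw ⊕ (s * E * w) ⊛ Lt′t ⊕ (s * E * t) ⊛ Lgw)
    identity)
  where
  identity : 4 * (s * E) * (2 * (L * R)) +
    (8 * L * (s * E) * (M + t′ * w + t * g) + 8 * L * (s * ((suc E * w + s * E) * t)) + s * (w * t) * E + s * E * t * w + s * E * w * t + s * E * t * w + 0) ≡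
    4 * (s * E) * (w * t) +
    (8 * L * (s * E) * (R + t * w) + 8 * L * (s * E * M) + s * (w * t) * (8 * L) + s * E * t * (8 * (L * s)) + s * E * w * (8 * (L * t′)) + s * E * t * (8 * (L * g)))
  identity = solve (s ∷ E ∷ L ∷ t ∷ t′ ∷ w ∷ g ∷ R ∷ M ∷ [])

-- With ν + 2 = 40E the lower bound reads sEd ≥ (E - 1/20)w², so the surplus satisfies ny ≤
-- (21/20)w². Since y > 19n/20, having w < 19n/20 would contradict (21/20)(19/20) = 399/400 < 1.
pruned-large : ∀ {s E ν w d n y} → 1 ≤ E → ν + 2 ≡ 40 * E → n ≡ s * E + y → 20 * (s * E) < n →
  ν * (w * w) ≤ s * (ν + 2) * d → s * E * d + n * y ≤ suc E * (w * w) → 19 * n ≤ 20 * w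
pruned-large {s} {E} {ν} {w} {d} {n} {y} 1≤E ν+2 n≡ sE<n lower upper = ≮⇒≥ λ small → impossible small
  where
  20ny≤21ww : 20 * (n * y) ≤ 21 * (w * w)
  20ny≤21ww = *-cancelˡ-≤ (2 * E) {{m*n≢0 2 E {{_}} {{>-nonZero 1≤E}}}} (≤-cert 0
    (E ⊛ subst (λ k → ν * (w * w) ≤ s * k * d) ν+2 lower ⊕ (40 * E) ⊛ upper ⊕ (E * (w * w)) ⊛ ≤-reflexive (sym ν+2)) identity)
    where
    identity : 2 * E * (20 * (n * y)) + (E * (s * (40 * E) * d) + 40 * E * (suc E * (w * w)) + E * (w * w) * (ν + 2) + 0) ≡
      2 * E * (21 * (w * w)) + (E * (ν * (w * w)) + 40 * E * (s * E * d + n * y) + E * (w * w) * (40 * E))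
    identity = solve (E ∷ n ∷ y ∷ s ∷ d ∷ w ∷ ν ∷ [])
  impossible : ¬ (20 * w < 19 * n)
  impossible small = contradiction 1≤0 λ ()
    where
    8000y≤7581n : 8000 * y ≤ 7581 * n
    8000y≤7581n = *-cancelˡ-≤ n {{>-nonZero (≤-<-trans z≤n sE<n)}} (≤-cert 0
      (400 ⊛ 20ny≤21ww ⊕ 21 ⊛ *-mono-≤ (<⇒≤ small) (<⇒≤ small)) identity)
      where
      identity : n * (8000 * y) + (400 * (21 * (w * w)) + 21 * (19 * n * (19 * n)) + 0) ≡
        n * (7581 * n) + (400 * (20 * (n * y)) + 21 * (20 * w * (20 * w)))
      identity = solve (n ∷ y ∷ w ∷ [])
    1≤0 : 1 ≤ 0
    1≤0 = ≤-cert (418 + 380 * (s * E)) (8000y≤7581n ⊕ 8000 ⊛ ≤-reflexive n≡ ⊕ 419 ⊛ sE<n) identity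
      where
      identity : 1 + (7581 * n + 8000 * (s * E + y) + 419 * n + (418 + 380 * (s * E))) ≡ 0 + (8000 * y + 8000 * n + 419 * suc (20 * (s * E)))
      identity = solve (n ∷ y ∷ s ∷ E ∷ [])

-- Stability

does-refuted : ∀ {ℓ} {A : Set ℓ} (A? : Dec A) → not (does A?) ≡ true → ¬ A
does-refuted (no ¬a) _ = ¬a

term≤∑∈ : ∀ (A : Subset n) f x → x ∈ A → f x ≤ ∑∈ A f
term≤∑∈ A f x x∈ = ≤-trans (≤-reflexive (trans (sym (*-identityˡ _)) (cong (λ b → 𝟙 b * f x) (sym x∈))))
                           (term≤∑ (λ y → 𝟙 (A y) * f y) x)

β≤0⇒adj : ∀ (G : SimpleGraph n) x y → β G x y ≤ 0 → adj G x y ≡ true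
β≤0⇒adj G x y β≤0 with adj G x y | β≤0
... | true | _ = refl

CommonNeighbours : SimpleGraph n → Subset n → Subset n → Set
CommonNeighbours G A N = ∀ z x → z ∈ A → x ∈ N → adj G z x ≡ true

half-identity : ∀ h t x y → 2 * h + (t + t + 2 * (x + y) + 0) ≡ 2 * x + (2 * y + 2 * h + 2 * t)
half-identity h t x y = solve (h ∷ t ∷ x ∷ y ∷ [])

cover-identity : ∀ w N B S →
  5 * (7 * w) + (60 * (N + (B + S)) + 2 * (11 * w) + 3 * w + 0) ≡ 5 * (12 * N) + (60 * w + 2 * (30 * B) + 3 * (20 * S))
cover-identity w N B S = solve (w ∷ N ∷ B ∷ S ∷ [])

-- Most vertices of one part miss few of the vertices that are not sparse to that part.
large-common-neighbourhood : ∀ (G : SimpleGraph n) {W s t} (K : CompletePartite G W s t) (a : Fin s) {E L t′ h} →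
  3 ≤ s → 8 * L ≤ E → L ≡ 20 * h → 1 ≤ h → 8 * (L * t′) ≤ t → 1 ≤ t′ →
  8 * (L * s) ≤ # W → 8 * (L * # (fullSet G K t′)) ≤ # W → MinDegree G (s * E) (suc E) W →
  ∃ λ A → ∃ λ N → # A ≡ h × CommonNeighbours G A N × 7 * # W ≤ 12 * # N
large-common-neighbourhood {n} G {W} {s} {t} K a {E} {L} {t′} {h} 3≤s LE L≡ 1≤h Lt′t 1≤t′ Lsw Lgw deg =
  A , N , #A , common , 7w≤12N
  where
  open CompletePartite K
  w = # W
  g = # (fullSet G K t′)
  1≤s : 1 ≤ s
  1≤s = ≤-trans (s≤s z≤n) 3≤s
  1≤L : 1 ≤ L
  1≤L = subst (1 ≤_) (sym L≡) (≤-trans 1≤h (m≤n*m h 20))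
  40≤8L : 40 ≤ 8 * L
  40≤8L = subst (λ l → 40 ≤ 8 * l) (sym L≡) (≤-trans (m≤m+n 40 120) (8 ⊛ 20 ⊛ 1≤h))
  40≤8L* : ∀ x → 40 * x ≤ 8 * (L * x)
  40≤8L* x = ≤-trans (*-monoˡ-≤ x 40≤8L) (≤-reflexive (*-assoc 8 L x))
  1≤w : 1 ≤ w
  1≤w = ≤-trans (≤-trans 1≤s (m≤n*m s 40)) (≤-trans (40≤8L* s) Lsw)
  1≤E : 1 ≤ E
  1≤E = ≤-trans (s≤s z≤n) (≤-trans 40≤8L LE)
  1≤t : 1 ≤ t
  1≤t = ≤-trans (≤-trans 1≤t′ (m≤n*m t′ 40)) (≤-trans (40≤8L* t′) Lt′t)
  sp B rest : Subset n
  sp   = sparse G K t′ a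
  B    = W ∩ sp
  rest = W ∩ ∁ sp
  m = ∑∈ W (missing G K a)
  few-in-B : 30 * # B ≤ 11 * w
  few-in-B = sparse-bound {s} {E} {t} {t′} {w} {# B} {m} 3≤s (≤-trans 40≤8L LE) (≤-trans (40≤8L* s) Lsw)
      (≤-trans (40≤8L* t′) Lt′t) 1≤t low (part-missing-bound G K {r = suc E} deg a)
    where
    open ≤-Reasoning
    low : t * # B ≤ m + t′ * # B
    low = begin
      t * # B                                          ≡⟨ ∑∈-const B t ⟨
      ∑∈ B (λ _ → t)                                   ≤⟨ ∑∈-mono B (λ x x∈ → <⇒≤ (does-sound (t <? _) (∩-⊆ʳ W sp x x∈))) ⟩
      ∑∈ B (λ x → missing G K a x + t′)                ≡⟨ ∑∈-+ B _ _ ⟩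
      ∑∈ B (missing G K a) + ∑∈ B (λ _ → t′)           ≤⟨ ∑∈-⊆ _ (∩-⊆ˡ W sp) ⊕ ≤-reflexive (∑∈-const B t′) ⟩
      m + t′ * # B                                     ∎
  e : Fin n → ℕ
  e z = nd G rest z
  light : Subset n
  light z = does (L * e z ≤? w)
  heavy = part a ∩ ∁ light
  -- Markov's inequality: the values L · e(z) add up to at most wt/2 over the part, and each heavy
  -- vertex contributes more than w.
  few-heavy : 2 * # heavy ≤ t
  few-heavy = *-cancelˡ-≤ w {{>-nonZero 1≤w}} (begin
    w * (2 * # heavy)                  ≡⟨ x∙yz≈y∙xz w 2 (# heavy) ⟩
    2 * (w * # heavy)                  ≡⟨ cong (2 *_) (∑∈-const heavy w) ⟨
    2 * ∑∈ heavy (λ _ → w)             ≤⟨ 2 ⊛ ∑∈-mono heavy (λ z z∈ → <⇒≤ (≰⇒> (does-refuted (L * e z ≤? w) (∩-⊆ʳ (part a) (∁ light) z z∈)))) ⟩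
    2 * ∑∈ heavy (λ z → L * e z)       ≤⟨ 2 ⊛ ∑∈-⊆ _ (∩-⊆ˡ (part a) (∁ light)) ⟩
    2 * ∑∈ (part a) (λ z → L * e z)    ≡⟨ cong (2 *_) (∑∈-* (part a) L e) ⟩
    2 * (L * ∑∈ (part a) e)            ≡⟨ cong (λ k → 2 * (L * k)) (missing-swap G K a rest) ⟨
    2 * (L * ∑∈ rest (missing G K a))
      ≤⟨ 2 ⊛ L ⊛ term≤∑ (λ b → ∑∈ (W ∩ ∁ (sparse G K t′ b)) (missing G K b)) a ⟩
    2 * (L * residual G K t′)
      ≤⟨ residual-bound′ {s} {E} {L} {t} {t′} {w} {g} 1≤s 1≤E LE Lsw Lt′t Lgw (residual-bound G K t′) (totalMissing-bound G K {r = suc E} deg t′) ⟩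
    w * t                              ∎)
    where
    open ≤-Reasoning
  many-light : h ≤ # (part a ∩ light)
  many-light = *-cancelˡ-≤ 2 (≤-cert 0 (few-heavy ⊕ 2h≤t ⊕ 2 ⊛ ≤-reflexive split) (half-identity h t (# (part a ∩ light)) (# heavy)))
    where
    split : t ≡ # (part a ∩ light) + # heavy
    split = trans (sym (#part a)) (∑∈-split (part a) light _)
    2h≤t : 2 * h ≤ t
    2h≤t = begin
      2 * h                  ≤⟨ *-mono-≤ (m≤m+n 2 6) (m≤n*m h 20) ⟩
      8 * (20 * h)           ≡⟨ cong (8 *_) L≡ ⟨
      8 * L                  ≤⟨ 8 ⊛ m≤m*n L t′ {{>-nonZero 1≤t′}} ⟩
      8 * (L * t′)           ≤⟨ Lt′t ⟩
      t                      ∎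
      where open ≤-Reasoning
  chosen = subset-of-size (part a ∩ light) many-light
  A = proj₁ chosen
  A⊆ = proj₁ (proj₂ chosen)
  #A = proj₂ (proj₂ chosen)
  f : Fin n → ℕ
  f x = ∑∈ A (λ z → β G z x)
  seen N : Subset n
  seen x = does (f x ℕ≟ 0)
  N = W ∩ seen
  common : CommonNeighbours G A N
  common z x z∈ x∈ = β≤0⇒adj G z x (≤-trans (term≤∑∈ A (λ z → β G z x) z z∈)
    (≤-reflexive (does-sound (f x ℕ≟ 0) (∩-⊆ʳ W seen x x∈))))
  S = ∑∈ A e
  -- Here `L` is 20h: the `h` chosen light vertices miss at most w/L each, hence w/20 in total.
  20S≤w : 20 * S ≤ w
  20S≤w = *-cancelˡ-≤ h {{>-nonZero 1≤h}} (begin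
    h * (20 * S)              ≡⟨ trans (sym (*-assoc h 20 S)) (cong (_* S) (*-comm h 20)) ⟩
    20 * h * S                ≡⟨ cong (_* S) L≡ ⟨
    L * S                     ≡⟨ ∑∈-* A L e ⟨
    ∑∈ A (λ z → L * e z)      ≤⟨ ∑∈-≤const A w (λ z z∈ → does-sound (L * e z ≤? w) (∩-⊆ʳ (part a) light z (A⊆ z z∈))) ⟩
    w * # A                   ≡⟨ cong (w *_) #A ⟩
    w * h                     ≡⟨ *-comm w h ⟩
    h * w                     ∎)
    where
    open ≤-Reasoning
  -- A vertex of `W` outside `N` is either sparse to the part, hence in `B`, or lies in `rest` and
  -- misses a chosen vertex, hence is counted at least once in `S`.
  cover : w ≤ # N + (# B + S)
  cover = begin
    w                                                  ≡⟨ ∑∈-split W seen _ ⟩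
    # N + # U                                          ≡⟨ cong (# N +_) (∑∈-split U sp _) ⟩
    # N + (# (U ∩ sp) + # (U ∩ ∁ sp))                  ≤⟨ +-monoʳ-≤ (# N) (∑∈-⊆ _ inB ⊕ ≤-trans (∑∈-mono (U ∩ ∁ sp) unseen) (∑∈-⊆ f inRest)) ⟩
    # N + (# B + ∑∈ rest f)                            ≡⟨ cong (λ k → # N + (# B + k)) (∑∈-comm rest A (λ x z → β G z x)) ⟩
    # N + (# B + S)                                    ∎
    where
    open ≤-Reasoning
    U = W ∩ ∁ seen
    inB : (U ∩ sp) ⊆ B
    inB x x∈ = ∩-∈ W sp (∩-⊆ˡ W (∁ seen) x (∩-⊆ˡ U sp x x∈)) (∩-⊆ʳ U sp x x∈)
    inRest : (U ∩ ∁ sp) ⊆ rest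
    inRest x x∈ = ∩-∈ W (∁ sp) (∩-⊆ˡ W (∁ seen) x (∩-⊆ˡ U (∁ sp) x x∈)) (∩-⊆ʳ U (∁ sp) x x∈)
    unseen : ∀ x → x ∈ (U ∩ ∁ sp) → 1 ≤ f x
    unseen x x∈ = n≢0⇒n>0 (does-refuted (f x ℕ≟ 0) (∩-⊆ʳ W (∁ seen) x (∩-⊆ˡ U (∁ sp) x x∈)))
  7w≤12N : 7 * w ≤ 12 * # N
  7w≤12N = *-cancelˡ-≤ 5 (≤-cert 0 (60 ⊛ cover ⊕ 2 ⊛ few-in-B ⊕ 3 ⊛ 20S≤w) (cover-identity w (# N) (# B) S))

density-identity : ∀ s E n d y →
  s * E * d + n * y + (E * (n * (n + s)) + n * n + 0) ≡ suc E * (n * n) + (E * (s * d) + n * (s * E + y))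
density-identity s E n d y = solve (s ∷ E ∷ n ∷ d ∷ y ∷ [])

combine-identity : ∀ n C w N → 120 * (n + C) + (7 * (20 * w) + 20 * (12 * N) + 12 * n + n) ≡
  120 * (2 * N) + (7 * (19 * n) + 20 * (7 * w) + 12 * (10 * C))
combine-identity n C w N = solve (n ∷ C ∷ w ∷ N ∷ [])

-- The complete s-partite subgraph is found in a set W with |W| ≥ 19n/20; at most 11|W|/30 vertices of W are sparse
-- to the part considered and at most |W|/20 others miss a chosen vertex, and 2 (1 − 11/30 − 1/20) 19/20 > 1.
module Stability (s t′ h C : ℕ) (3≤s : 3 ≤ s) (1≤t′ : 1 ≤ t′) (1≤h : 1 ≤ h) where
  private
    L E q p ν fullBound W-bound : ℕ
    -- `E` has to be at least 8L to keep the residual small and at least `s` so that (s - 1)(E + 1)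
    -- < sE, which is what finding s parts requires. The size `p` makes the loss t′/p equal to
    -- 1/(8L), and ν + 2 = 40E is the precision used in `pruned-large`.
    L = 20 * h
    E = 8 * (L * s)
    q = s * E
    p = 8 * (L * t′)
    ν = 40 * E ∸ 2
    fullBound = 2 ^ (s * p) * t′
    W-bound = (ν + 2) * partiteBound (suc s) (s * (ν + 2)) t′ + (partiteBound s q p + (8 * (L * s) + 8 * (L * fullBound)))

    1≤s : 1 ≤ s
    1≤s = ≤-trans (s≤s z≤n) 3≤s
    1≤L : 1 ≤ L
    1≤L = *-mono-≤ {1} {20} (s≤s z≤n) 1≤h
    8L≤E : 8 * L ≤ E
    8L≤E = 8 ⊛ m≤m*n L s {{>-nonZero 1≤s}}
    s≤E : s ≤ E
    s≤E = ≤-trans (m≤n*m s L {{>-nonZero 1≤L}}) (m≤n*m (L * s) 8)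
    1≤E : 1 ≤ E
    1≤E = ≤-trans 1≤s s≤E
    1≤p : 1 ≤ p
    1≤p = *-mono-≤ {1} {8} (s≤s z≤n) (*-mono-≤ 1≤L 1≤t′)
    ν+2 : ν + 2 ≡ 40 * E
    ν+2 = m∸n+n≡m (≤-trans (s≤s (s≤s z≤n)) (40 ⊛ 1≤E))
    ratio : ∀ i → i < s → i * suc E < q
    ratio i i<s = ≤-cert 0 (E ⊛ i<s ⊕ ≤-trans i<s s≤E) (identity E i s)
      where
      identity : ∀ E i s → suc (i * suc E) + (E * s + E + 0) ≡ s * E + (E * suc i + suc i)
      identity E i s = solve (E ∷ i ∷ s ∷ [])

  threshold : ℕ
  threshold = suc (20 * q + suc E * (W-bound * W-bound) + 10 * C)

  stability : ∀ (G : SimpleGraph n) → threshold ≤ n → (∀ W → ¬ CompletePartite G W (suc s) t′) →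
    s * D G full ≤ n * (n + s) →
    ∃ λ A → ∃ λ N → # A ≡ h × CommonNeighbours G A N × n + C ≤ 2 * # N
  stability {n} G large no-K dense = result
    where
    20q<n : 20 * q < n
    20q<n = ≤-trans (s≤s (≤-trans (m≤m+n _ _) (m≤m+n _ _))) large
    q<n : q < n
    q<n = ≤-<-trans (m≤n*m q 20) 20q<n
    n≡ : n ≡ q + (n ∸ q)
    n≡ = sym (m+[n∸m]≡n (<⇒≤ q<n))
    -- The surplus n(n - q) is exactly what the Turán bound leaves below (E + 1)n²: with q = sE it
    -- gives q · D ≤ En² + qn.
    dense′ : q * D G full + n * (n ∸ q) ≤ suc E * (# (full {n}) * # (full {n}))
    dense′ = subst (λ m → q * D G full + n * (n ∸ q) ≤ suc E * (m * m)) (sym (#full n))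
      (≤-cert 0 (E ⊛ dense ⊕ n ⊛ ≤-reflexive (sym n≡)) (density-identity s E n (D G full) (n ∸ q)))
    pruned = prune G q (suc E) (n * (n ∸ q)) full dense′
    W = proj₁ pruned
    denseW = proj₁ (proj₂ pruned)
    deg = proj₂ (proj₂ pruned)
    result : ∃ λ A → ∃ λ N → # A ≡ h × CommonNeighbours G A N × n + C ≤ 2 * # N
    result = A , N , proj₁ props , proj₁ (proj₂ props) , *-cancelˡ-≤ 120
        (≤-cert n (7 ⊛ 19n≤20w ⊕ 20 ⊛ proj₂ (proj₂ props) ⊕ 12 ⊛ 10C≤n) (combine-identity n C w (# N)))
      where
      w = # W
      -- The surplus survives pruning, so (E + 1)w² ≥ n(n - q) ≥ n, and `threshold` was chosen to
      -- exceed (E + 1) times the square of `W-bound`.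
      W-bound<w : W-bound < w
      W-bound<w = ≰⇒> λ w≤ → <⇒≱ {n} {n} (begin-strict
        n                              ≤⟨ m≤m*n n (n ∸ q) {{>-nonZero (m<n⇒0<n∸m q<n)}} ⟩
        n * (n ∸ q)                    ≤⟨ m≤n+m _ (q * D G W) ⟩
        q * D G W + n * (n ∸ q)        ≤⟨ denseW ⟩
        suc E * (w * w)                ≤⟨ suc E ⊛ *-mono-≤ w≤ w≤ ⟩
        suc E * (W-bound * W-bound)    <⟨ ≤-trans (s≤s (≤-trans (m≤n+m _ (20 * q)) (m≤m+n _ (10 * C)))) large ⟩
        n                              ∎) ≤-refl
        where open ≤-Reasoning
      nonadj : ν * (w * w) < s * (ν + 2) * D G W
      nonadj = nonadjacency-lower-bound s ν G 1≤s 1≤t′ no-K W (≤-<-trans (m≤m+n _ _) W-bound<w)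
      19n≤20w : 19 * n ≤ 20 * w
      19n≤20w = pruned-large {s} {E} {ν} {w} {D G W} {n} {n ∸ q} 1≤E ν+2 n≡ 20q<n (<⇒≤ nonadj) denseW
      large-w : partiteBound s q p + (8 * (L * s) + 8 * (L * fullBound)) < w
      large-w = ≤-<-trans (m≤n+m _ ((ν + 2) * partiteBound (suc s) (s * (ν + 2)) t′)) W-bound<w
      K : CompletePartite G W s p
      K = find-partite {r = suc E} s G 1≤p (*-mono-≤ 1≤s 1≤E) ratio deg (≤-<-trans (m≤m+n _ _) large-w)
      large-w′ : 8 * (L * s) + 8 * (L * fullBound) ≤ w
      large-w′ = ≤-trans (m≤n+m _ (partiteBound s q p)) (<⇒≤ large-w)
      -- More full vertices would extend `K` to s + 1 parts of size `t′`, which `no-K` excludes.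
      few-full : # (fullSet G K t′) ≤ fullBound
      few-full = <⇒≤ (≰⇒> λ big → no-K W (extend G K t′ 1≤t′ big))
      found = large-common-neighbourhood G K (fromℕ< 1≤s) {E} {L} {t′} {h} 3≤s 8L≤E refl 1≤h ≤-refl 1≤t′
        (≤-trans (m≤m+n _ _) large-w′) (≤-trans (≤-trans (8 ⊛ L ⊛ few-full) (m≤n+m _ (8 * (L * s)))) large-w′) deg
      A = proj₁ found
      N = proj₁ (proj₂ found)
      props = proj₂ (proj₂ found)
      10C≤n : 10 * C ≤ n
      10C≤n = ≤-trans (m≤n+m (10 * C) (20 * q + suc E * (W-bound * W-bound))) (<⇒≤ large)

-- Turán graphs

<ᵇ-true : ∀ {a b} → a < b → (a <ᵇ b) ≡ true
<ᵇ-true a<b = Equivalence.to T-≡ (<⇒<ᵇ a<b)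

<ᵇ-false : ∀ {a b} → ¬ a < b → (a <ᵇ b) ≡ false
<ᵇ-false {a} {b} a≮b with a <ᵇ b in eq
... | false = refl
... | true  = contradiction (<ᵇ⇒< a b (Equivalence.from T-≡ eq)) a≮b

-- Every ordered pair is counted exactly once: as an edge in one of its two orientations, or as a
-- non-adjacency, which includes the diagonal.
edgeCount-D : ∀ (G : SimpleGraph n) → 2 * edgeCount G + D G full ≡ n * n
edgeCount-D {n} G = begin
  2 * edgeCount G + D G full                      ≡⟨ cong₂ (λ x y → 2 * x + y) as-∑ (∑-cong λ i → trans (*-identityˡ _) (∑-cong λ j → *-identityˡ _)) ⟩
  2 * S + ∑ (λ i → ∑ λ j → β G i j)               ≡⟨ cong (λ x → S + x + ∑ (λ i → ∑ λ j → β G i j)) (trans (+-identityʳ S) (∑-swap φ)) ⟩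
  S + ∑ (λ i → ∑ λ j → φ j i) + ∑ (λ i → ∑ λ j → β G i j)
    ≡⟨ cong (_+ ∑ (λ i → ∑ λ j → β G i j)) (sym (∑∑-+ φ (λ i j → φ j i))) ⟩
  ∑ (λ i → ∑ λ j → φ i j + φ j i) + ∑ (λ i → ∑ λ j → β G i j)
    ≡⟨ ∑∑-+ (λ i j → φ i j + φ j i) (β G) ⟨
  ∑ (λ i → ∑ λ j → φ i j + φ j i + β G i j)       ≡⟨ ∑-cong (λ i → trans (∑-cong (pointwise i)) (∑-const n 1)) ⟩
  ∑ {n} (λ i → n * 1)                             ≡⟨ ∑-const n (n * 1) ⟩
  n * (n * 1)                                     ≡⟨ cong (n *_) (*-identityʳ n) ⟩
  n * n                                           ∎
  where
  open ≡-Reasoning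
  φ : Fin n → Fin n → ℕ
  φ i j = if (toℕ i <ᵇ toℕ j) ∧ adj G i j then 1 else 0
  S = ∑ (λ i → ∑ (φ i))
  as-∑ : edgeCount G ≡ S
  as-∑ = trans (list-sum _) (∑-cong λ i → list-sum (φ i))
  ∑∑-+ : ∀ (f g : Fin n → Fin n → ℕ) → ∑ (λ i → ∑ λ j → f i j + g i j) ≡ ∑ (λ i → ∑ (f i)) + ∑ (λ i → ∑ (g i))
  ∑∑-+ f g = trans (∑-cong λ i → ∑-+ (f i) (g i)) (∑-+ _ _)
  pointwise : ∀ i j → φ i j + φ j i + β G i j ≡ 1
  pointwise i j with <-cmp (toℕ i) (toℕ j)
  ... | tri< i<j _ j≮i rewrite <ᵇ-true i<j | <ᵇ-false j≮i with adj G i j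
  ...   | true  = refl
  ...   | false = refl
  pointwise i j | tri> i≮j _ j<i rewrite <ᵇ-true j<i | <ᵇ-false i≮j | adj-sym G i j with adj G j i
  ...   | true  = refl
  ...   | false = refl
  pointwise i j | tri≈ i≮j i≡j j≮i rewrite <ᵇ-false i≮j | <ᵇ-false j≮i | toℕ-injective i≡j | adj-irrefl G j = refl

module Turán (s₁ : ℕ) where
  private
    s = suc s₁

  colour : ℕ → Fin s
  colour i = i mod s

  turán : ∀ n → SimpleGraph n
  turán n = record
    { adj    = λ i j → not (colour (toℕ i) == colour (toℕ j))
    ; sym    = λ i j → cong not (==-sym (colour (toℕ i)) (colour (toℕ j)))
    ; irrefl = λ i → cong not (==-refl (colour (toℕ i)))
    }
    where
    ==-sym : ∀ {m} (i j : Fin m) → (i == j) ≡ (j == i)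
    ==-sym i j with i ≟ j
    ... | yes refl = sym (==-refl i)
    ... | no i≢j with j ≟ i
    ...   | yes j≡i = contradiction (sym j≡i) i≢j
    ...   | no _    = refl

  turán-proper : ∀ {n} (i j : Fin n) → T (adj (turán n) i j) → colour (toℕ i) ≢ colour (toℕ j)
  turán-proper i j ij same rewrite same | ==-refl (colour (toℕ j)) = ij

  classSize : ℕ → Fin s → ℕ
  classSize n c = ∑ {n} λ j → 𝟙 (c == colour (toℕ j))

  class-blocks : ∀ k c → classSize (k * s) c ≤ k
  class-blocks zero    c = ≤-reflexive (∑-empty c)
    where
    ∑-empty : ∀ c → classSize 0 c ≡ 0
    ∑-empty c = trans (∑-cong {g = λ _ → 0} (λ ())) (∑-const 0 0)
  class-blocks (suc k) c = begin
    classSize (s + k * s) c                                              ≡⟨ ∑-append s (λ i → 𝟙 (c == colour i)) ⟩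
    classSize s c + ∑ {k * s} (λ j → 𝟙 (c == colour (s + toℕ j)))        ≡⟨ cong₂ _+_ one (∑-cong {k * s} λ j → cong (λ x → 𝟙 (c == x)) (periodic (toℕ j))) ⟩
    1 + classSize (k * s) c                                              ≤⟨ s≤s (class-blocks k c) ⟩
    suc k                                                                ∎
    where
    open ≤-Reasoning
    periodic : ∀ i → colour (s + i) ≡ colour i
    periodic i = toℕ-injective (trans (toℕ-fromℕ< (m%n<n (s + i) s))
      (trans (trans (cong (_% s) (+-comm s i)) ([m+n]%n≡m%n i s)) (sym (toℕ-fromℕ< (m%n<n i s)))))
    colour-toℕ : ∀ (j : Fin s) → colour (toℕ j) ≡ j
    colour-toℕ j = toℕ-injective (trans (toℕ-fromℕ< (m%n<n (toℕ j) s)) (m<n⇒m%n≡m (toℕ<n j)))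
    one : classSize s c ≡ 1
    one = trans (∑-cong {s} λ j → trans (cong (λ x → 𝟙 (c == x)) (colour-toℕ j)) (flip-== c j)) (∑-δ (λ _ → 1) c)
      where
      flip-== : ∀ (c j : Fin s) → 𝟙 (c == j) ≡ 𝟙 (j == c) * 1
      flip-== c j with c ≟ j
      ... | yes refl rewrite ==-refl c = refl
      ... | no c≢j with j ≟ c
      ...   | yes j≡c = contradiction (sym j≡c) c≢j
      ...   | no _    = refl

  -- Round `n` up to the multiple (⌊n/s⌋ + 1)s: each block of `s` consecutive numbers meets the
  -- class once.
  class-bound : ∀ n c → s * classSize n c ≤ n + s
  class-bound n c = begin
    s * classSize n c                ≤⟨ s ⊛ monotone (suc (n / s) * s) n (≤-trans n≤ (≤-reflexive (+-comm (n / s * s) s))) ⟩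
    s * classSize (suc (n / s) * s) c      ≤⟨ s ⊛ class-blocks (suc (n / s)) c ⟩
    s * suc (n / s)                  ≡⟨ identity s (n / s) ⟩
    n / s * s + s                    ≤⟨ +-monoˡ-≤ s (≤-trans (m≤n+m _ (n % s)) (≤-reflexive (sym (m≡m%n+[m/n]*n n s)))) ⟩
    n + s                            ∎
    where
    open ≤-Reasoning
    identity : ∀ s x → s * suc x ≡ x * s + s
    identity s x = solve (s ∷ x ∷ [])
    n≤ : n ≤ n / s * s + s
    n≤ = begin
      n                       ≡⟨ m≡m%n+[m/n]*n n s ⟩
      n % s + n / s * s       ≤⟨ +-monoˡ-≤ _ (<⇒≤ (m%n<n n s)) ⟩
      s + n / s * s           ≡⟨ +-comm s _ ⟩
      n / s * s + s           ∎
    monotone : ∀ N n → n ≤ N → classSize n c ≤ classSize N c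
    monotone N n n≤N = subst (λ N → classSize n c ≤ classSize N c) (m+[n∸m]≡n n≤N)
      (≤-trans (m≤m+n _ _) (≤-reflexive (sym (∑-append n (λ i → 𝟙 (c == colour i))))))

  D-turán : ∀ n → s * D (turán n) full ≤ n * (n + s)
  D-turán n = begin
    s * D (turán n) full                         ≡⟨ ∑∈-* full s (nd (turán n) full) ⟨
    ∑∈ full (λ i → s * nd (turán n) full i)      ≤⟨ ∑∈-≤const full (n + s) (λ i _ → ≤-trans (≤-reflexive (cong (s *_) (nd-class i))) (class-bound n (colour (toℕ i)))) ⟩
    (n + s) * # (full {n})                       ≡⟨ cong ((n + s) *_) (#full n) ⟩
    (n + s) * n                                  ≡⟨ *-comm (n + s) n ⟩
    n * (n + s)                                  ∎
    where
    open ≤-Reasoning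
    nd-class : ∀ i → nd (turán n) full i ≡ classSize n (colour (toℕ i))
    nd-class i = ∑-cong λ j → trans (*-identityˡ _) (cong 𝟙 (not-involutive _))

-- Rewiring a vertex

-- Whether a vertex lies in the image of a copy is not decided, since the vertices of a pattern form
-- an arbitrary type. Finiteness of the index set lets the double negation pass through the
-- quantifier.
¬¬-∀ : ∀ {m} {P : Fin m → Set} → (∀ i → ¬ ¬ P i) → ¬ ¬ (∀ i → P i)
¬¬-∀ {zero}  _ k = k λ ()
¬¬-∀ {suc m} f k = f zero λ p₀ → ¬¬-∀ (f ∘ suc) λ p → k λ { zero → p₀ ; (suc i) → p i }

module Rewire (G : SimpleGraph n) (v : Fin n) (M : Subset n) where

  rewired : SimpleGraph n
  rewired = record { adj = adj′ ; sym = sym′ ; irrefl = irrefl′ }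
    where
    adj′ : Fin n → Fin n → Bool
    adj′ i j with i ≟ v | j ≟ v
    ... | yes _ | yes _ = false
    ... | yes _ | no  _ = M j
    ... | no  _ | yes _ = M i
    ... | no  _ | no  _ = adj G i j
    sym′ : ∀ i j → adj′ i j ≡ adj′ j i
    sym′ i j with i ≟ v | j ≟ v
    ... | yes _ | yes _ = refl
    ... | yes _ | no  _ = refl
    ... | no  _ | yes _ = refl
    ... | no  _ | no  _ = adj-sym G i j
    irrefl′ : ∀ i → adj′ i i ≡ false
    irrefl′ i with i ≟ v
    ... | yes _ = refl
    ... | no  _ = adj-irrefl G i

  D-rewired : D rewired (full ∖ v) ≡ D G (full ∖ v)
  D-rewired = ∑∈-cong (full ∖ v) λ i i∈ → ∑∈-cong (full ∖ v) λ j j∈ →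
    cong (𝟙 ∘ not) (unchanged i j (∖-≢ full v i i∈) (∖-≢ full v j j∈))
    where
    unchanged : ∀ i j → i ≢ v → j ≢ v → adj rewired i j ≡ adj G i j
    unchanged i j i≢v j≢v with i ≟ v | j ≟ v
    ... | yes i≡v | _       = contradiction i≡v i≢v
    ... | no _    | yes j≡v = contradiction j≡v j≢v
    ... | no _    | no _    = refl

  nd-rewired : nd rewired full v + # (M ∖ v) ≡ n
  nd-rewired = trans (sym (∑-+ _ _)) (trans (∑-cong pointwise) (trans (∑-const n 1) (*-identityʳ n)))
    where
    pointwise : ∀ j → 1 * β rewired v j + 𝟙 ((M ∖ v) j) * 1 ≡ 1
    pointwise j with v ≟ v
    ... | no v≢v = contradiction refl v≢v
    ... | yes _ with j ≟ v
    ...   | yes _ with M j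
    ...     | true  = refl
    ...     | false = refl
    pointwise j | yes _ | no _ with M j
    ...     | true  = refl
    ...     | false = refl

  edgeCount-rewired : nd rewired full v < nd G full v → edgeCount G < edgeCount rewired
  edgeCount-rewired fewer = *-cancelˡ-< 2 _ _ (≤-cert 1
    (2 ⊛ fewer ⊕ ≤-reflexive (edgeCount-D G) ⊕ ≤-reflexive (sym (edgeCount-D rewired))
      ⊕ ≤-reflexive (D-∖ rewired full v refl) ⊕ ≤-reflexive (sym (D-∖ G full v refl)) ⊕ ≤-reflexive D-rewired)
    (identity (edgeCount G) (edgeCount rewired) (D G full) (D rewired full) (D G (full ∖ v)) (D rewired (full ∖ v)) (nd G full v) (nd rewired full v) (n * n)))
    where
    identity : ∀ e e′ d d′ f f′ k k′ N → suc (2 * e) + (2 * k + N + (2 * e′ + d′) + (f′ + 2 * k′) + (d + 1) + f + 1) ≡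
      2 * e′ + (2 * suc k′ + (2 * e + d) + N + (d′ + 1) + (f + 2 * k) + f′)
    identity e e′ d d′ f f′ k k′ N = solve (e ∷ e′ ∷ d ∷ d′ ∷ f ∷ f′ ∷ k ∷ k′ ∷ N ∷ [])

  -- A copy of H through v can use instead some vertex of A that it does not contain.
  rewired-free : ∀ (H : Pattern) {h} (code : V H → Fin h) → Injective _≡_ _≡_ code →
    ∀ A → # A ≡ suc h → CommonNeighbours G A M → Free H G → Free H rewired
  rewired-free H {h} code code-inj A #A common free (φ , φ-inj , φ-adj) =
    ¬¬-∀ (λ j avoided → replace j (λ x eq → avoided (x , eq))) covered
    where
    enumeration = enumerate A (≤-reflexive (sym #A))
    a : Fin (suc h) → Fin n
    a = proj₁ enumeration
    a-inj : Injective _≡_ _≡_ a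
    a-inj = proj₁ (proj₂ enumeration)
    a∈ : ∀ j → a j ∈ A
    a∈ = proj₂ (proj₂ enumeration)
    covered : ¬ (∀ j → ∃ λ x → φ x ≡ a j)
    covered hit with i , j , i<j , same ← pigeonhole (n<1+n h) (λ j → code (proj₁ (hit j))) =
      Fin-<⇒≢ i<j (a-inj (trans (sym (proj₂ (hit i))) (trans (cong φ (code-inj same)) (proj₂ (hit j)))))
    replace : ∀ j → ¬ (∀ x → φ x ≢ a j)
    replace j avoid = free (φ′ , φ′-inj , φ′-adj)
      where
      φ′ : V H → Fin n
      φ′ x with φ x ≟ v
      ... | yes _ = a j
      ... | no  _ = φ x
      φ′-inj : Injective _≡_ _≡_ φ′
      φ′-inj {x} {y} eq with φ x ≟ v | φ y ≟ v
      ... | yes p | yes q = φ-inj (trans p (sym q))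
      ... | yes _ | no  _ = contradiction (sym eq) (avoid y)
      ... | no  _ | yes _ = contradiction eq (avoid x)
      ... | no  _ | no  _ = φ-inj eq
      φ′-adj : ∀ x y → Adj H x y → T (adj G (φ′ x) (φ′ y))
      φ′-adj x y xy with φ x ≟ v | φ y ≟ v | φ-adj x y xy
      ... | yes _ | no _  | y∈M = Equivalence.from T-≡ (common (a j) (φ y) (a∈ j) (Equivalence.to T-≡ y∈M))
      ... | no _  | yes _ | x∈M = Equivalence.from T-≡
              (trans (adj-sym G (φ x) (a j)) (common (a j) (φ x) (a∈ j) (Equivalence.to T-≡ x∈M)))
      ... | no _  | no _  | xy′ = xy′

#≤suc-∖ : ∀ (A : Subset n) v → # A ≤ suc (# (A ∖ v))
#≤suc-∖ A v with A v in eq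
... | true  = ≤-reflexive (#-∖ A v eq)
... | false = ≤-trans (∑∈-⊆ _ (λ x x∈ → ∖-∈ A v x x∈ (avoids x x∈))) (n≤1+n _)
  where
  avoids : ∀ x → x ∈ A → x ≢ v
  avoids x x∈ refl with () ← trans (sym x∈) eq

embed-partite : ∀ (H : Pattern) {m h t} (G : SimpleGraph n) {W} (colour : V H → Fin m) →
  (∀ x y → Adj H x y → colour x ≢ colour y) → (code : V H → Fin h) → Injective _≡_ _≡_ code →
  h ≤ t → CompletePartite G W m t → Contains H G
embed-partite {n} H {m} {h} G colour proper code code-inj h≤t K = φ , φ-inj , φ-adj
  where
  open CompletePartite K
  place : ∀ a → Σ (Fin h → Fin n) λ e → Injective _≡_ _≡_ e × (∀ i → e i ∈ part a)
  place a = enumerate (part a) (≤-trans h≤t (≤-reflexive (sym (#part a))))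
  φ : V H → Fin n
  φ x = proj₁ (place (colour x)) (code x)
  φ∈ : ∀ x → φ x ∈ part (colour x)
  φ∈ x = proj₂ (proj₂ (place (colour x))) (code x)
  adjacent : ∀ x y → colour x ≢ colour y → adj G (φ x) (φ y) ≡ true
  adjacent x y x≢y = complete (φ x) (φ y) x≢y (φ∈ x) (φ∈ y)
  same-part : ∀ {a b} i j → a ≡ b → proj₁ (place a) i ≡ proj₁ (place b) j → i ≡ j
  same-part {a} i j refl eq = proj₁ (proj₂ (place a)) eq
  φ-inj : Injective _≡_ _≡_ φ
  φ-inj {x} {y} eq with colour x ≟ colour y
  ... | yes same = code-inj (same-part _ _ same eq)
  ... | no  diff with () ← trans (sym (adj-irrefl G (φ x))) (trans (cong (adj G (φ x)) eq) (adjacent x y diff))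
  φ-adj : ∀ x y → Adj H x y → T (adj G (φ x) (φ y))
  φ-adj x y xy = Equivalence.from T-≡ (adjacent x y (proper x y xy))

-- Embedding the odd-ballooning

-- In this form any two vertices have more than `c` common neighbours, because their
-- non-neighbourhoods together have fewer than n - c vertices. Hence `c` used vertices never block a
-- choice.
Dense : SimpleGraph n → ℕ → Set
Dense {n} G c = ∀ v → 2 * nd G full v + c < n

module Greedy (G : SimpleGraph n) (c : ℕ) (dense : Dense G c) where

  Fresh : Subset n → Fin n → Fin n → Fin n → Set
  Fresh U a b x = U x ≡ false × adj G a x ≡ true × adj G b x ≡ true

  fresh? : ∀ U a b → Dec (∃ (Fresh U a b))
  fresh? U a b = any? λ x → (U x Bool≟ false) ×-dec (adj G a x Bool≟ true) ×-dec (adj G b x Bool≟ true)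

  fresh-exists : ∀ U a b → # U ≤ c → ¬ ¬ ∃ (Fresh U a b)
  fresh-exists U a b #U≤c none = contradiction {A = 1 ≤ 0}
      (≤-cert 1 (dense a ⊕ dense b ⊕ 2 ⊛ cover ⊕ 2 ⊛ #U≤c) (identity (nd G full a) (nd G full b) (# U) c n)) λ ()
    where
    identity : ∀ x y u c n → 1 + (n + n + 2 * (x + y + u) + 2 * c + 1) ≡ 0 + (suc (2 * x + c) + suc (2 * y + c) + 2 * n + 2 * u)
    identity x y u c n = solve (x ∷ y ∷ u ∷ c ∷ n ∷ [])
    pointwise : ∀ x → 1 ≤ 1 * β G a x + 1 * β G b x + 𝟙 (U x) * 1
    pointwise x with U x in eq₁ | adj G a x in eq₂ | adj G b x in eq₃
    ... | true  | _     | _     = m≤n+m 1 _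
    ... | false | false | _     = s≤s z≤n
    ... | false | true  | false = s≤s z≤n
    ... | false | true  | true  = contradiction (x , eq₁ , eq₂ , eq₃) none
    cover : n ≤ nd G full a + nd G full b + # U
    cover = begin
      n                                                            ≡⟨ trans (∑-const n 1) (*-identityʳ n) ⟨
      ∑ {n} (λ _ → 1)                                              ≤⟨ ∑-mono pointwise ⟩
      ∑ (λ x → 1 * β G a x + 1 * β G b x + 𝟙 (U x) * 1)            ≡⟨ trans (∑-+ _ _) (cong (_+ # U) (∑-+ _ _)) ⟩
      nd G full a + nd G full b + # U                              ∎
      where open ≤-Reasoning

  abstract
    pick : Subset n → Fin n → Fin n → Fin n
    pick U a b with fresh? U a b
    ... | yes (x , _) = x
    -- A default, never reached while `# U ≤ c`.
    ... | no _        = a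

    pick-fresh : ∀ U a b → # U ≤ c → Fresh U a b (pick U a b)
    pick-fresh U a b #U≤c with fresh? U a b
    ... | yes (_ , fresh) = fresh
    ... | no none = contradiction none (fresh-exists U a b #U≤c)

  -- Vertex q of the walk is a new common neighbour of tgt q and of src q applied to its predecessor.
  module Walk (U₀ : Subset n) (w₀ : Fin n) (src : ℕ → Fin n → Fin n) (tgt : ℕ → Fin n) where

    used : ℕ → Subset n
    latest : ℕ → Fin n
    used zero    = U₀
    used (suc q) x = (x == latest (suc q)) ∨ used q x
    latest zero    = w₀
    latest (suc q) = pick (used q) (src q (latest q)) (tgt q)

    walk : ℕ → Fin n
    walk q = latest (suc q)

    #used : ∀ q → # (used q) ≤ # U₀ + q
    #used zero    = ≤-reflexive (sym (+-identityʳ _))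
    #used (suc q) = begin
      # (used (suc q))                                                ≤⟨ ∑-mono (λ x → 𝟙-∨ (x == walk q) (used q x)) ⟩
      ∑ (λ x → 𝟙 (x == walk q) * 1 + 𝟙 (used q x) * 1)                ≡⟨ ∑-+ _ _ ⟩
      ∑ (λ x → 𝟙 (x == walk q) * 1) + # (used q)                      ≡⟨ cong (_+ # (used q)) (∑-δ (λ _ → 1) (walk q)) ⟩
      suc (# (used q))                                                ≤⟨ s≤s (#used q) ⟩
      suc (# U₀ + q)                                                  ≡⟨ +-suc (# U₀) q ⟨
      # U₀ + suc q                                                    ∎
      where
      open ≤-Reasoning
      𝟙-∨ : ∀ a b → 𝟙 (a ∨ b) * 1 ≤ 𝟙 a * 1 + 𝟙 b * 1
      𝟙-∨ true  b = s≤s z≤n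
      𝟙-∨ false b = ≤-refl

    walk-fresh : ∀ q → # U₀ + q ≤ c → Fresh (used q) (src q (latest q)) (tgt q) (walk q)
    walk-fresh q ≤c = pick-fresh (used q) _ _ (≤-trans (#used q) ≤c)

    walk∈used : ∀ q → walk q ∈ used (suc q)
    walk∈used q = cong (_∨ used q (walk q)) (==-refl (walk q))

    used-suc : ∀ q → used q ⊆ used (suc q)
    used-suc q x x∈ with x == walk q
    ... | true  = refl
    ... | false = x∈

    used-mono : ∀ d {q} → used q ⊆ used (d + q)
    used-mono zero    x x∈ = x∈
    used-mono (suc d) x x∈ = used-suc _ x (used-mono d x x∈)

    walk-unused : ∀ {q q′ x} → q ≤ q′ → # U₀ + q′ ≤ c → x ∈ used q → x ≢ walk q′
    walk-unused {q} {q′} q≤q′ ≤c x∈ refl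
      with () ← trans (sym (subst (λ r → walk q′ ∈ used r) (m∸n+n≡m q≤q′) (used-mono (q′ ∸ q) _ x∈))) (proj₁ (walk-fresh q′ ≤c))

image : ∀ {k} → (Fin k → Fin n) → Subset n
image f x = does (any? λ u → f u ≟ x)

∈-image : ∀ {k} (f : Fin k → Fin n) u → f u ∈ image f
∈-image f u = dec-true (any? λ u′ → f u′ ≟ f u) (u , refl)

#image : ∀ {k} (f : Fin k → Fin n) → # (image f) ≤ k
#image {k = k} f = begin
  # (image f)                                 ≤⟨ ∑-mono pointwise ⟩
  ∑ (λ x → ∑ λ u → 𝟙 (x == f u) * 1)          ≡⟨ ∑-swap _ ⟩
  ∑ (λ u → ∑ λ x → 𝟙 (x == f u) * 1)          ≡⟨ ∑-cong (λ u → ∑-δ (λ _ → 1) (f u)) ⟩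
  ∑ {k} (λ _ → 1)                             ≡⟨ trans (∑-const k 1) (*-identityʳ k) ⟩
  k                                           ∎
  where
  open ≤-Reasoning
  pointwise : ∀ x → 𝟙 (image f x) * 1 ≤ ∑ λ u → 𝟙 (x == f u) * 1
  pointwise x with any? (λ u → f u ≟ x)
  ... | no _ = z≤n
  ... | yes (u , refl) = ≤-trans (≤-reflexive (cong (λ b → 𝟙 b * 1) (sym (==-refl (f u)))))
                                 (term≤∑ (λ u′ → 𝟙 (f u == f u′) * 1) u)

extend-ℕ : ∀ {A : Set} {N} → A → (Fin N → A) → ℕ → A
extend-ℕ {N = N} d g q with q <? N
... | yes q<N = g (fromℕ< q<N)
... | no _    = d

extend-ℕ-toℕ : ∀ {A : Set} {N} d (g : Fin N → A) i → extend-ℕ d g (toℕ i) ≡ g i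
extend-ℕ-toℕ {N = N} d g i with toℕ i <? N
... | yes i<N = cong g (fromℕ<-toℕ i i<N)
... | no i≮N  = contradiction (toℕ<n i) i≮N

if-zero : ∀ {A : Set} → ℕ → A → A → A
if-zero zero    a b = a
if-zero (suc _) a b = b

module Ballooning {k} (F : SimpleGraph k) (ℓ : Fin k → Fin k → ℕ) where

  -- A crude common bound for the numbers of internal vertices. The slots fill the whole box k × k ×
  -- K, and the walk also visits those that belong to no path; in exchange, successive internal
  -- vertices of a path have consecutive numbers in lexicographic order.
  K : ℕ
  K = ∑ λ u → ∑ λ v → ℓ u v ∸ 2

  ℓ-2≤K : ∀ u v → ℓ u v ∸ 2 ≤ K
  ℓ-2≤K u v = ≤-trans (term≤∑ (λ v → ℓ u v ∸ 2) v) (term≤∑ (λ u → ∑ λ v → ℓ u v ∸ 2) u)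

  slots order : ℕ
  slots = k * (k * K)
  order = k + slots

  index : Fin k → Fin k → Fin K → Fin slots
  index u v i = combine u (combine v i)

  unindex : Fin slots → Fin k × Fin k × Fin K
  unindex x = proj₁ (remQuot {k} (k * K) x) , remQuot {k} K (proj₂ (remQuot {k} (k * K) x))

  unindex-index : ∀ u v i → unindex (index u v i) ≡ (u , v , i)
  unindex-index u v i = trans
    (cong (λ r → proj₁ r , remQuot {k} K (proj₂ r)) (remQuot-combine {k} {k * K} u (combine v i)))
    (cong (u ,_) (remQuot-combine {k} {K} v i))

  slot : BVert F ℓ → Fin k ⊎ Fin slots
  slot (inj₁ u) = inj₁ u
  slot (inj₂ (u , v , p , i)) = inj₂ (index u v (inject≤ i (ℓ-2≤K u v)))

  slot-injective : Injective _≡_ _≡_ slot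
  slot-injective {inj₁ u} {inj₁ u′} eq = cong inj₁ (inj₁-injective eq)
  slot-injective {inj₁ _} {inj₂ _} ()
  slot-injective {inj₂ _} {inj₁ _} ()
  slot-injective {inj₂ (u , v , p , i)} {inj₂ (u′ , v′ , p′ , i′)} eq
    with refl , eq′ ← combine-injective u (combine v _) u′ (combine v′ _) (inj₂-injective eq)
    with refl , eq″ ← combine-injective v _ v′ _ eq′
    with refl ← inject≤-injective _ _ i i′ eq″
    = cong (λ p → inj₂ (u , v , p , i)) (T-irrelevant p p′)

  code : BVert F ℓ → Fin order
  code x = join k slots (slot x)

  code-injective : Injective _≡_ _≡_ code
  code-injective {x} {y} eq = slot-injective (trans (sym (splitAt-join k slots (slot x)))
    (trans (cong (splitAt k) eq) (splitAt-join k slots (slot y))))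

  restrict : ∀ (G : SimpleGraph n) → Contains (OddBallooning F ℓ) G → Contains (toPattern F) G
  restrict G (φ , φ-inj , φ-adj) =
    φ ∘ inj₁ , (λ eq → inj₁-injective (φ-inj eq)) , λ u v uv → φ-adj (inj₁ u) (inj₁ v) (base u v uv)

  balloon : ∀ (G : SimpleGraph n) → Fin n → Dense G order → Contains (toPattern F) G → Contains (OddBallooning F ℓ) G
  balloon {n} G w₀ dense (f , f-inj , f-adj) = φ , φ-inj , φ-adj
    where
    start : Fin k × Fin k × Fin K → Fin n → Fin n
    -- At the first slot of a path the predecessor in the walk belongs elsewhere, so the path
    -- restarts from `f u`.
    start (u , v , i) w = if-zero (toℕ i) (f u) w
    src : ℕ → Fin n → Fin n
    src = extend-ℕ (λ w → w) (start ∘ unindex)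
    -- Every vertex of the path for `u`, `v` is made adjacent to `f v`, so the path may end at
    -- whichever slot `ℓ u v` prescribes. The default `w₀` concerns numbers beyond the last slot
    -- only.
    tgt : ℕ → Fin n
    tgt = extend-ℕ w₀ (λ x → f (proj₁ (proj₂ (unindex x))))
    open Greedy G order dense
    open Walk (image f) w₀ src tgt
    small : (x : Fin slots) → # (image f) + toℕ x ≤ order
    small x = +-mono-≤ (#image f) (<⇒≤ (toℕ<n x))
    place : Fin k ⊎ Fin slots → Fin n
    place (inj₁ u) = f u
    place (inj₂ x) = walk (toℕ x)
    place-injective : Injective _≡_ _≡_ place
    place-injective {inj₁ u} {inj₁ v} eq = cong inj₁ (f-inj eq)
    place-injective {inj₁ u} {inj₂ x} eq = contradiction eq (walk-unused z≤n (small x) (∈-image f u))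
    place-injective {inj₂ x} {inj₁ u} eq = contradiction (sym eq) (walk-unused z≤n (small x) (∈-image f u))
    place-injective {inj₂ x} {inj₂ y} eq with <-cmp (toℕ x) (toℕ y)
    ... | tri< x<y _ _ = contradiction eq (walk-unused x<y (small y) (walk∈used (toℕ x)))
    ... | tri≈ _ x≡y _ = cong inj₂ (toℕ-injective x≡y)
    ... | tri> _ _ y<x = contradiction (sym eq) (walk-unused y<x (small x) (walk∈used (toℕ y)))
    φ : BVert F ℓ → Fin n
    φ x = place (slot x)
    φ-inj : Injective _≡_ _≡_ φ
    φ-inj eq = slot-injective (place-injective eq)
    start-zero : ∀ {u v} (i : Fin K) w → toℕ i ≡ 0 → start (u , v , i) w ≡ f u
    start-zero {u} i w i≡0 = cong (λ m → if-zero m (f u) w) i≡0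
    start-suc : ∀ {u v m} (i : Fin K) w → toℕ i ≡ suc m → start (u , v , i) w ≡ w
    start-suc {u} i w i≡ = cong (λ m → if-zero m (f u) w) i≡
    src-index : ∀ u v i w → src (toℕ (index u v i)) w ≡ start (u , v , i) w
    src-index u v i w = cong (λ g → g w) (trans (extend-ℕ-toℕ (λ w → w) (start ∘ unindex) (index u v i)) (cong start (unindex-index u v i)))
    tgt-index : ∀ u v i → tgt (toℕ (index u v i)) ≡ f v
    tgt-index u v i = trans (extend-ℕ-toℕ w₀ _ (index u v i)) (cong (λ r → f (proj₁ (proj₂ r))) (unindex-index u v i))
    toℕ-index : ∀ u v i → toℕ (index u v i) ≡ k * K * toℕ u + (K * toℕ v + toℕ i)
    toℕ-index u v i = trans (toℕ-combine u (combine v i)) (cong (k * K * toℕ u +_) (toℕ-combine v i))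
    index-suc : ∀ u v i j → toℕ j ≡ suc (toℕ i) → toℕ (index u v j) ≡ suc (toℕ (index u v i))
    index-suc u v i j j≡ = trans (toℕ-index u v j) (trans (cong (λ m → k * K * toℕ u + (K * toℕ v + m)) j≡)
      (trans (trans (cong (k * K * toℕ u +_) (+-suc (K * toℕ v) (toℕ i))) (+-suc (k * K * toℕ u) _)) (cong suc (sym (toℕ-index u v i)))))
    pos : ∀ {u v} → Fin (ℓ u v ∸ 2) → Fin K
    pos {u} {v} i = inject≤ i (ℓ-2≤K u v)
    toℕ-pos : ∀ {u v} (i : Fin (ℓ u v ∸ 2)) → toℕ (pos {u} {v} i) ≡ toℕ i
    toℕ-pos {u} {v} i = toℕ-inject≤ i (ℓ-2≤K u v)
    from-src : ∀ u v i {w} → start (u , v , i) (latest (toℕ (index u v i))) ≡ w → T (adj G w (walk (toℕ (index u v i))))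
    from-src u v i refl = Equivalence.from T-≡ (trans (cong (λ w → adj G w (walk (toℕ (index u v i)))) (sym (src-index u v i _)))
      (proj₁ (proj₂ (walk-fresh (toℕ (index u v i)) (small (index u v i))))))
    from-tgt : ∀ u v i → T (adj G (walk (toℕ (index u v i))) (f v))
    from-tgt u v i = Equivalence.from T-≡ (trans (adj-sym G _ _) (trans (cong (λ w → adj G w (walk (toℕ (index u v i)))) (sym (tgt-index u v i)))
      (proj₂ (proj₂ (walk-fresh (toℕ (index u v i)) (small (index u v i)))))))
    φ-adj : ∀ x y → BAdj F ℓ x y → T (adj G (φ x) (φ y))
    φ-adj _ _ (base u v uv) = f-adj u v uv
    φ-adj _ _ (first u v p i i≡0) = from-src u v (pos i) (start-zero {u} {v} (pos i) _ (trans (toℕ-pos i) i≡0))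
    φ-adj _ _ (step u v p i j j≡) = from-src u v (pos j) (trans (start-suc {u} {v} (pos j) _ (trans (toℕ-pos j) j≡))
      (cong latest (index-suc u v (pos i) (pos j) (trans (toℕ-pos j) (trans j≡ (cong suc (sym (toℕ-pos i))))))))
    φ-adj _ _ (last u v p i _) = from-tgt u v (pos i)
    φ-adj _ _ (symm x y xy) = subst T (adj-sym G (φ x) (φ y)) (φ-adj x y xy)

-- Colourings of `F` and of its odd-ballooning

Colourable : ∀ {k} → SimpleGraph k → ℕ → Set
Colourable {k} F m = Σ (Fin k → Fin m) λ c → ∀ u v → T (adj F u v) → c u ≢ c v

colourable? : ∀ {k} (F : SimpleGraph k) m → Dec (Colourable F m)
colourable? {k} F m = map′ (λ (x , proper) → finToFun x , proper) encode
  (any? λ x → all? λ u → all? λ v → T? (adj F u v) →-dec ¬? (finToFun {m} {k} x u ≟ finToFun x v))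
  where
  encode : Colourable F m → ∃ λ x → ∀ u v → T (adj F u v) → finToFun {m} {k} x u ≢ finToFun x v
  encode (c , proper) = funToFin c , λ u v uv eq → proper u v uv
    (trans (sym (finToFun-funToFin c u)) (trans eq (finToFun-funToFin c v)))

colourable-by-vertices : ∀ {k} (F : SimpleGraph k) d → Colourable F (k + d)
colourable-by-vertices F d = (_↑ˡ d) , λ u v uv eq →
  subst T (trans (cong (λ w → adj F w v) (↑ˡ-injective d u v eq)) (adj-irrefl F v)) uv

-- An upward search from `m` with fuel `d`: colourability is decidable, and the known colouring with
-- d + m colours makes the search stop.
chromatic-number : ∀ {k} (F : SimpleGraph k) d m → ¬ Colourable F m → Colourable F (d + m) →
  ∃ λ e → ¬ Colourable F (e + m) × Colourable F (suc (e + m))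
chromatic-number F zero    m ¬c c = contradiction c ¬c
chromatic-number F (suc d) m ¬c c with colourable? F (suc m)
... | yes c′ = 0 , ¬c , c′
... | no ¬c′ with e , ¬ce , ce ← chromatic-number F d (suc m) ¬c′ (subst (Colourable F) (sym (+-suc d m)) c) =
  suc e , subst (λ x → ¬ Colourable F x) (+-suc e m) ¬ce , subst (λ x → Colourable F (suc x)) (+-suc e m) ce

alternate : ∀ {A : Set} → ℕ → A → A → A
alternate zero    a b = a
alternate (suc i) a b = alternate i b a

alternate-≢ : ∀ {A : Set} i {a b : A} → a ≢ b → alternate i a b ≢ alternate i b a
alternate-≢ zero    a≢b = a≢b
alternate-≢ (suc i) a≢b = alternate-≢ i (a≢b ∘ sym)

-- The parity is stated for `3 + i` because this is the length of the cycle when `i` is the last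
-- internal index.
alternate-even : ∀ {A : Set} i {a b : A} → (3 + i) % 2 ≡ 1 → alternate i a b ≡ a
alternate-even zero          _   = refl
alternate-even (suc zero)    ()
alternate-even (suc (suc i)) odd = alternate-even i odd

third : ∀ {m} (a b : Fin (3 + m)) → ∃ λ c → c ≢ a × c ≢ b
third zero          zero          = suc zero , (λ ()) , λ ()
third zero          (suc zero)    = suc (suc zero) , (λ ()) , λ ()
third zero          (suc (suc _)) = suc zero , (λ ()) , λ ()
third (suc zero)    zero          = suc (suc zero) , (λ ()) , λ ()
third (suc (suc _)) zero          = suc zero , (λ ()) , λ ()
third (suc _)       (suc _)       = zero , (λ ()) , λ ()

-- Along the path from u to v the colours alternate between a third colour and the colour of u; since the path
-- has an odd number of internal vertices, it ends with the third colour.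
balloon-colouring : ∀ {k m} (F : SimpleGraph k) (ℓ : Fin k → Fin k → ℕ) → ValidLengths F ℓ → Colourable F (3 + m) →
  Σ (BVert F ℓ → Fin (3 + m)) λ colour → ∀ x y → BAdj F ℓ x y → colour x ≢ colour y
balloon-colouring {k} {m} F ℓ valid (c , proper) = colour , colour-proper
  where
  other : Fin k → Fin k → Fin (3 + m)
  other u v = proj₁ (third (c u) (c v))
  other-≢ˡ : ∀ u v → other u v ≢ c u
  other-≢ˡ u v = proj₁ (proj₂ (third (c u) (c v)))
  other-≢ʳ : ∀ u v → other u v ≢ c v
  other-≢ʳ u v = proj₂ (proj₂ (third (c u) (c v)))
  colour : BVert F ℓ → Fin (3 + m)
  colour (inj₁ u) = c u
  colour (inj₂ (u , v , _ , i)) = alternate (toℕ i) (other u v) (c u)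
  length-parity : ∀ {l i} → 5 ≤ l → l % 2 ≡ 1 → suc i ≡ l ∸ 2 → (3 + i) % 2 ≡ 1
  length-parity {suc (suc l)} {i} _ odd refl = odd
  length-parity {suc zero} (s≤s ()) _ _
  colour-proper : ∀ x y → BAdj F ℓ x y → colour x ≢ colour y
  colour-proper _ _ (base u v uv) = proper u v uv
  colour-proper _ _ (first u v p i i≡0) rewrite i≡0 = other-≢ˡ u v ∘ sym
  colour-proper _ _ (step u v p i j j≡) rewrite j≡ = alternate-≢ (toℕ i) (other-≢ˡ u v)
  colour-proper _ _ (last u v p i i≡) eq = other-≢ʳ u v
    (trans (sym (alternate-even (toℕ i) (length-parity (proj₂ (valid u v p)) (proj₁ (valid u v p)) i≡))) eq)
  colour-proper _ _ (symm x y xy) = colour-proper x y xy ∘ sym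

-- Extremal graphs

edgeCount-≤⇒D-≥ : ∀ (G G′ : SimpleGraph n) → edgeCount G ≤ edgeCount G′ → D G′ full ≤ D G full
edgeCount-≤⇒D-≥ {n} G G′ fewer = ≤-cert 0
  (2 ⊛ fewer ⊕ ≤-reflexive (edgeCount-D G′) ⊕ ≤-reflexive (sym (edgeCount-D G)))
  (identity (edgeCount G) (edgeCount G′) (D G full) (D G′ full) (n * n))
  where
  identity : ∀ e e′ d d′ N → d′ + (2 * e′ + N + (2 * e + d) + 0) ≡ d + (2 * e + (2 * e′ + d′) + N)
  identity e e′ d d′ N = solve (e ∷ e′ ∷ d ∷ d′ ∷ N ∷ [])

edgeCount≤n² : ∀ (G : SimpleGraph n) → edgeCount G ≤ n * n
edgeCount≤n² G = ≤-trans (m≤n*m (edgeCount G) 2) (≤-trans (m≤m+n _ _) (≤-reflexive (edgeCount-D G)))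

-- Of the constant 4, two units pay for the rewired vertex possibly lying in the common
-- neighbourhood itself, and two for the strictness of the gain.
rewiring-gain : ∀ {n h m N k k′} → n + (h + 4) ≤ 2 * N → N ≤ suc m → k′ + m ≡ n → n ≤ 2 * k + h → suc k′ ≤ k
rewiring-gain {n} {h} {m} {N} {k} {k′} large N≤ split low = *-cancelˡ-≤ 2 (≤-cert 0
  (large ⊕ 2 ⊛ N≤ ⊕ 2 ⊛ ≤-reflexive split ⊕ low) identity)
  where
  identity : 2 * suc k′ + (2 * N + 2 * suc m + 2 * n + (2 * k + h) + 0) ≡ 2 * k + (n + (h + 4) + 2 * N + 2 * (k′ + m) + n)
  identity = solve (n ∷ h ∷ m ∷ N ∷ k ∷ k′ ∷ [])

module _ (H : Pattern) {h : ℕ} (code : V H → Fin h) (code-inj : Injective _≡_ _≡_ code) where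

  -- If v had low degree, joining it instead to a large common neighbourhood would gain edges.
  extremal-dense : ∀ (G : SimpleGraph n) {A N} → # A ≡ suc h → CommonNeighbours G A N → n + (h + 4) ≤ 2 * # N →
    InEX H n G → Dense G h
  extremal-dense {n} G {A} {N} #A common large (free , maximal) v = ≰⇒> λ low →
    <⇒≱ (edgeCount-rewired (rewiring-gain large (#≤suc-∖ N v) nd-rewired low))
        (maximal rewired (rewired-free H code code-inj A #A common free))
    where open Rewire G v N

  -- Starting from a larger H-free graph and improving it as long as possible.
  larger-extremal : ∀ (G : SimpleGraph n) → Free H G → ¬ (∀ (G′ : SimpleGraph n) → InEX H n G′ → ¬ edgeCount G ≤ edgeCount G′)
  larger-extremal {n} G free none = improve (n * n) G free ≤-refl (m≤n+m (n * n) (edgeCount G))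
    where
    -- `d` bounds the number of improvements still possible, as no graph has more than n² edges.
    improve : ∀ d (G′ : SimpleGraph n) → Free H G′ → edgeCount G ≤ edgeCount G′ → n * n ≤ edgeCount G′ + d → ⊥
    improve d G′ free′ above bound = none G′ (free′ , λ G″ free″ → ≮⇒≥ λ more → next d G″ free″ more bound) above
      where
      next : ∀ d (G″ : SimpleGraph n) → Free H G″ → edgeCount G′ < edgeCount G″ → n * n ≤ edgeCount G′ + d → ⊥
      next zero    G″ _ more bound = <⇒≱ more (≤-trans (edgeCount≤n² G″) (subst (n * n ≤_) (+-identityʳ _) bound))
      next (suc d) G″ free″ more bound = improve d G″ free″ (≤-trans above (<⇒≤ more))
        (≤-trans bound (≤-trans (≤-reflexive (+-suc _ d)) (+-monoˡ-≤ d more)))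

theorem1p2 : ∀ {k} (F : SimpleGraph k) (ℓ : Fin k → Fin k → ℕ) →
    ChromaticGE4 F → ValidLengths F ℓ →
    Σ ℕ λ n₀ → ∀ n → n₀ ≤ n → ∀ (G : SimpleGraph n) →
    InEX (OddBallooning F ℓ) n G ⇔ InEX (toPattern F) n G
theorem1p2 {k} F ℓ χ≥4 valid = threshold , λ n large G → mk⇔ (to large G) (from large G)
  where
  open Ballooning F ℓ
  Fᵒ = OddBallooning F ℓ
  χ = chromatic-number F k 3 χ≥4 (colourable-by-vertices F 3)
  s₁ = 2 + proj₁ χ
  s = suc s₁
  ¬colourable : ¬ Colourable F s
  ¬colourable = subst (λ m → ¬ Colourable F m) (+-comm (proj₁ χ) 3) (proj₁ (proj₂ χ))
  colourable : Colourable F (suc s)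
  colourable = subst (λ m → Colourable F (suc m)) (+-comm (proj₁ χ) 3) (proj₂ (proj₂ χ))
  open Stability s (suc order) (suc order) (order + 4) (m≤m+n 3 (proj₁ χ)) (s≤s z≤n) (s≤s z≤n)
  open Turán s₁
  colouring : Σ (BVert F ℓ → Fin (suc s)) λ colour → ∀ x y → BAdj F ℓ x y → colour x ≢ colour y
  colouring = balloon-colouring F ℓ valid colourable
  turán-free : ∀ n → Free Fᵒ (turán n)
  turán-free n copy with f , _ , f-adj ← restrict (turán n) copy =
    ¬colourable (colour ∘ toℕ ∘ f , λ u v uv → turán-proper (f u) (f v) (f-adj u v uv))
  extremal-free : ∀ {n} → threshold ≤ n → (G : SimpleGraph n) → InEX Fᵒ n G → Free (toPattern F) G
  extremal-free {n} large G ex@(free , maximal) copy =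
    free (balloon G (fromℕ< (≤-trans (s≤s z≤n) large)) (extremal-dense Fᵒ code code-injective G #A common big ex) copy)
    where
    no-K : ∀ W → ¬ CompletePartite G W (suc s) (suc order)
    no-K W K = free (embed-partite Fᵒ G (proj₁ colouring) (proj₂ colouring) code code-injective (n≤1+n order) K)
    found = stability G large no-K (≤-trans (s ⊛ edgeCount-≤⇒D-≥ (turán n) G (maximal (turán n) (turán-free n))) (D-turán n))
    #A = proj₁ (proj₂ (proj₂ found))
    common = proj₁ (proj₂ (proj₂ (proj₂ found)))
    big = proj₂ (proj₂ (proj₂ (proj₂ found)))
  to : ∀ {n} → threshold ≤ n → (G : SimpleGraph n) → InEX Fᵒ n G → InEX (toPattern F) n G
  to large G ex = extremal-free large G ex , λ G′ free → proj₂ ex G′ (free ∘ restrict G′)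
  from : ∀ {n} → threshold ≤ n → (G : SimpleGraph n) → InEX (toPattern F) n G → InEX Fᵒ n G
  -- If some Fᵒ-free `G′` beat `G`, an Fᵒ-extremal `G″` above it would be F-free and beat `G` as
  -- well. An inequality of numbers can be proved by refutation, so it is enough that the existence
  -- of such a `G″` cannot be refuted.
  from large G (free , maximal) = free ∘ restrict G , λ G′ free′ → ≮⇒≥ λ more →
    larger-extremal Fᵒ code code-injective G′ free′ λ G″ ex above →
      <⇒≱ more (≤-trans above (maximal G″ (extremal-free large G″ ex)))
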